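{- Let $x,y$ be distinct variables. The problem $\mathrm{MC}(\mathrm{dep}(x,y)\lor\mathrm{dep}(y,x))$ is $\mathrm{L}$-hard under first-order reductions.
   Context: A team $T$ with domain $X$ (a finite set of variables) and range $A$ is a set of assignments $s\colon X\to A$. $T\models\mathrm{dep}(v,w)$ iff for all $s_1,s_2\in T$ with $s_1(v)=s_2(v)$ we have $s_1(w)=s_2(w)$. $T\models\varphi_1\lor\varphi_2$ iff there are teams $T_1,T_2$ with $T=T_1\cup T_2$, $T_1\models\varphi_1$ and $T_2\models\varphi_2$. For a fixed $\varphi$, the problem $\mathrm{MC}(\varphi)$ is: given a finite team $T$ with finite range and finite domain containing the variables of $\varphi$, decide whether $T\models\varphi$. A team $T$ with domain $\{x,y\}$ is encoded as a finite structure with one binary relation $\mathrm{Rel}(T)=\{(s(x),s(y))\mid s\in T\}$. $\mathrm{L}$ is deterministic logarithmic space. First-order reductions are in the sense of Immerman (descriptive complexity): many-one reductions given by first-order queries between classes of finite (ordered) structures. -}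

module Defs where

open import Level using (Level; 0ℓ; Lift) renaming (suc to lsuc)
open import Data.Bool.Base using (Bool; true; false; T; if_then_else_)
open import Data.Bool.Properties using (T?)
open import Data.Fin.Base using (Fin; zero; toℕ; fromℕ<; opposite)
import Data.Fin.Properties as Fin
open import Data.List.Base as List
  using (List; []; _∷_; _++_; [_]; length; replicate; filter; concatMap;
         allFin; cartesianProductWith; applyDownFrom)
open import Data.Maybe.Base using (Maybe; just; nothing)
open import Data.Nat.Base
  using (ℕ; zero; suc; _+_; _*_; _^_; _≤_; _<_; _≡ᵇ_; _⊓_; pred; NonZero; z<s)
open import Data.Nat.DivMod using (_/_; _%_)
open import Data.Nat.Logarithm using (⌈log₂_⌉)
import Data.Nat.Properties as ℕ
open import Data.Product.Base using (Σ-syntax; ∃-syntax; _×_; _,_; proj₁)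
open import Data.Product using (∃!)
open import Data.Sum.Base using (_⊎_)
open import Data.Vec.Base as Vec using (Vec; []; _∷_)
open import Function.Bundles using (_⇔_)
open import Relation.Binary.PropositionalEquality using (_≡_)
open import Relation.Nullary.Decidable
  using (Dec; does; ¬?; _×-dec_; _⊎-dec_)
open import Relation.Nullary.Negation using (¬_)
open import Relation.Unary using (Pred; _∈_; _∪_; _≐_)

------------------------------------------------------------------------
-- Dependence logic

-- The variables of a formula range over the domain X of the teams that
-- interpret it.
data TeamFormula (X : Set) : Set where
  dep : X → X → TeamFormula X
  _∨_ : TeamFormula X → TeamFormula X → TeamFormula X

Team : Set → Set → Set₁
Team X A = Pred (X → A) 0ℓ

infix 4 _⊨_

_⊨_ : ∀ {X A} → Team X A → TeamFormula X → Set₁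
S ⊨ dep v w =
  Lift (lsuc 0ℓ) (∀ s₁ s₂ → s₁ ∈ S → s₂ ∈ S → s₁ v ≡ s₂ v → s₁ w ≡ s₂ w)
S ⊨ φ₁ ∨ φ₂ =
  ∃[ S₁ ] ∃[ S₂ ] S ≐ (S₁ ∪ S₂) × (S₁ ⊨ φ₁) × (S₂ ⊨ φ₂)

Rel : ∀ {X A} → X → X → Team X A → Pred (A × A) 0ℓ
Rel x y S (a , b) = ∃[ s ] s ∈ S × s x ≡ a × s y ≡ b

------------------------------------------------------------------------
-- Finite ordered structures (Immerman, Descriptive Complexity)

record Vocabulary : Set where
  field
    #rel      : ℕ
    arity     : Fin #rel → ℕ
    arity-pos : ∀ R → NonZero (arity R)
    #con      : ℕ

open Vocabulary public

-- The universe is {0,…,size-1} with its natural order; as in Immerman,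
-- structures have at least two elements, so that 0 and 1 are distinct.
record Structure (σ : Vocabulary) : Set where
  field
    size   : ℕ
    size≥2 : 2 ≤ size
    rel    : (R : Fin (#rel σ)) → Vec (Fin size) (arity σ R) → Bool
    con    : Fin (#con σ) → Fin size

open Structure public

Universe : ∀ {σ} → Structure σ → Set
Universe 𝔄 = Fin (size 𝔄)

Problem : Vocabulary → (ℓ : Level) → Set (lsuc ℓ)
Problem σ ℓ = Pred (Structure σ) ℓ

-- Bit i of a, bit 0 being the least significant one.
bit : ℕ → ℕ → Bool
bit a i = (_/_ a (2 ^ i) {{ℕ.m^n≢0 2 i}} % 2) ≡ᵇ 1

-- All k-tuples over Fin n in lexicographic order, leftmost entry most
-- significant.
tuples : ∀ n k → List (Vec (Fin n) k)
tuples n zero    = [ [] ]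
tuples n (suc k) = cartesianProductWith _∷_ (allFin n) (tuples n k)

------------------------------------------------------------------------
-- First-order logic with the numeric relations =, ≤, SUC, PLUS, TIMES,
-- BIT and the numeric constants 0, 1, max

data Term (σ : Vocabulary) (m : ℕ) : Set where
  var              : Fin m → Term σ m
  con′             : Fin (#con σ) → Term σ m
  min′ one′ max′   : Term σ m

-- Formulas with free variables in Fin m; quantifiers bind variable zero.
data Formula (σ : Vocabulary) (m : ℕ) : Set where
  rel′          : (R : Fin (#rel σ)) → Vec (Term σ m) (arity σ R) → Formula σ m
  _≈′_ _≤′_     : Term σ m → Term σ m → Formula σ m
  SUC BIT       : Term σ m → Term σ m → Formula σ m
  PLUS TIMES    : Term σ m → Term σ m → Term σ m → Formula σ m
  ¬′_           : Formula σ m → Formula σ m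
  _∧′_ _∨′_     : Formula σ m → Formula σ m → Formula σ m
  ∀′_ ∃′_       : Formula σ (suc m) → Formula σ m

module _ {σ : Vocabulary} (𝔄 : Structure σ) where

  ⟦_⟧ : ∀ {m} → Term σ m → Vec (Universe 𝔄) m → Universe 𝔄
  ⟦ var i ⟧ ρ = Vec.lookup ρ i
  ⟦ con′ c ⟧ ρ = con 𝔄 c
  ⟦ min′  ⟧ ρ = fromℕ< (ℕ.<-trans z<s (size≥2 𝔄))
  ⟦ one′  ⟧ ρ = fromℕ< (size≥2 𝔄)
  ⟦ max′  ⟧ ρ = opposite (fromℕ< (ℕ.<-trans z<s (size≥2 𝔄)))

  ⟦_⟧ℕ : ∀ {m} → Term σ m → Vec (Universe 𝔄) m → ℕ
  ⟦ t ⟧ℕ ρ = toℕ (⟦ t ⟧ ρ)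

  Sat : ∀ {m} → Formula σ m → Vec (Universe 𝔄) m → Set
  Sat (rel′ R ts)     ρ = T (rel 𝔄 R (Vec.map (λ t → ⟦ t ⟧ ρ) ts))
  Sat (t ≈′ u)        ρ = ⟦ t ⟧ ρ ≡ ⟦ u ⟧ ρ
  Sat (t ≤′ u)        ρ = ⟦ t ⟧ℕ ρ ≤ ⟦ u ⟧ℕ ρ
  Sat (SUC t u)       ρ = suc (⟦ t ⟧ℕ ρ) ≡ ⟦ u ⟧ℕ ρ
  Sat (BIT t u)       ρ = T (bit (⟦ t ⟧ℕ ρ) (⟦ u ⟧ℕ ρ))
  Sat (PLUS t u v)    ρ = ⟦ t ⟧ℕ ρ + ⟦ u ⟧ℕ ρ ≡ ⟦ v ⟧ℕ ρ
  Sat (TIMES t u v)   ρ = ⟦ t ⟧ℕ ρ * ⟦ u ⟧ℕ ρ ≡ ⟦ v ⟧ℕ ρ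
  Sat (¬′ φ)          ρ = ¬ Sat φ ρ
  Sat (φ ∧′ ψ)        ρ = Sat φ ρ × Sat ψ ρ
  Sat (φ ∨′ ψ)        ρ = Sat φ ρ ⊎ Sat ψ ρ
  Sat (∀′ φ)          ρ = ∀ a → Sat φ (a ∷ ρ)
  Sat (∃′ φ)          ρ = ∃[ a ] Sat φ (a ∷ ρ)

  sat? : ∀ {m} (φ : Formula σ m) ρ → Dec (Sat φ ρ)
  sat? (rel′ R ts)    ρ = T? _
  sat? (t ≈′ u)       ρ = _ Fin.≟ _
  sat? (t ≤′ u)       ρ = _ ℕ.≤? _
  sat? (SUC t u)      ρ = _ ℕ.≟ _
  sat? (BIT t u)      ρ = T? _
  sat? (PLUS t u v)   ρ = _ ℕ.≟ _
  sat? (TIMES t u v)  ρ = _ ℕ.≟ _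
  sat? (¬′ φ)         ρ = ¬? (sat? φ ρ)
  sat? (φ ∧′ ψ)       ρ = sat? φ ρ ×-dec sat? ψ ρ
  sat? (φ ∨′ ψ)       ρ = sat? φ ρ ⊎-dec sat? ψ ρ
  sat? (∀′ φ)         ρ = Fin.all? (λ a → sat? φ (a ∷ ρ))
  sat? (∃′ φ)         ρ = Fin.any? (λ a → sat? φ (a ∷ ρ))

  -- The tuples satisfying φ, in lexicographic order.
  extension : ∀ {k} → Formula σ k → List (Vec (Universe 𝔄) k)
  extension {k} φ = filter (sat? φ) (tuples (size 𝔄) k)

------------------------------------------------------------------------
-- First-order queries and reductions

-- A dim-ary first-order query.  The universe of the image of 𝔄 is the set
-- of dim-tuples satisfying φ₀; a relation of arity a is defined by a
-- formula in a blocks of dim variables, and a constant by a formula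
-- satisfied by exactly one tuple of the new universe.
record Query (σ τ : Vocabulary) : Set where
  field
    dim        : ℕ
    φ₀         : Formula σ dim
    φ          : (R : Fin (#rel τ)) → Formula σ (arity τ R * dim)
    ψ          : Fin (#con τ) → Formula σ dim
    φ₀-size≥2  : ∀ 𝔄 → 2 ≤ length (extension 𝔄 φ₀)
    ψ-unique   : ∀ 𝔄 c →
      ∃! _≡_ (λ i → Sat 𝔄 (ψ c) (List.lookup (extension 𝔄 φ₀) i))

-- The tuples are renumbered along the lexicographic order, which thus
-- becomes the order of the image.
apply : ∀ {σ τ} → Query σ τ → Structure σ → Structure τ
apply I 𝔄 = record
  { size   = length (extension 𝔄 φ₀)
  ; size≥2 = φ₀-size≥2 𝔄
  ; rel    = λ R is →
      does (sat? 𝔄 (φ R) (Vec.concat (Vec.map (List.lookup (extension 𝔄 φ₀)) is)))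
  ; con    = λ c → proj₁ (ψ-unique 𝔄 c)
  }
  where open Query I

infix 4 _≤fo_

_≤fo_ : ∀ {σ τ ℓ ℓ′} → Problem σ ℓ → Problem τ ℓ′ → Set _
P ≤fo Q = ∃[ I ] (∀ 𝔄 → 𝔄 ∈ P ⇔ apply I 𝔄 ∈ Q)

------------------------------------------------------------------------
-- Deterministic Turing machines with a read-only input tape

data Symbol : Set where
  ⊢ ⊣ : Symbol                -- end markers of the input
  ‵_  : Bool → Symbol

data Dir : Set where
  left stay right : Dir

-- A state q with halt q ≡ just b is halting, accepting iff b ≡ true.
-- Zero is the blank symbol of the one-way infinite work tape.
record TM : Set where
  field
    #states  : ℕ
    #symbols : ℕ
  State = Fin #states
  Γ     = Fin (suc #symbols)
  field
    start : State
    halt  : State → Maybe Bool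
    δ     : State → Symbol → Γ → State × Γ × Dir × Dir

record Config (M : TM) : Set where
  constructor config
  open TM M
  field
    state   : State
    inHead  : ℕ
    wkHead  : ℕ
    wkTape  : ℕ → Γ

open Config public

-- The input tape holds ⊢ w ⊣.
readFrom : List Bool → ℕ → Symbol
readFrom []      _       = ⊣
readFrom (b ∷ w) zero    = ‵ b
readFrom (b ∷ w) (suc i) = readFrom w i

read : List Bool → ℕ → Symbol
read w zero    = ⊢
read w (suc i) = readFrom w i

move : Dir → ℕ → ℕ
move left  i = pred i
move stay  i = i
move right i = suc i

write : {A : Set} → (ℕ → A) → ℕ → A → ℕ → A
write f i a j = if i ≡ᵇ j then a else f j

module _ (M : TM) (w : List Bool) where
  open TM M

  -- The input head cannot leave the segment ⊢ w ⊣, which occupies the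
  -- cells 0,…,length w + 1.
  step : Config M → Config M
  step c@(config q i j f) with halt q
  ... | just _  = c
  ... | nothing =
    let q′ , a , dᵢ , dⱼ = δ q (read w i) (f j) in
    config q′ (move dᵢ i ⊓ suc (length w)) (move dⱼ j) (write f j a)

  run : ℕ → Config M
  run zero    = config start 0 0 (λ _ → zero)
  run (suc t) = step (run t)

  Accepts : Set
  Accepts = ∃[ t ] halt (state (run t)) ≡ just true

  Halts : Set
  Halts = ∃[ t ] ∃[ b ] halt (state (run t)) ≡ just b

  InSpace : ℕ → Set
  InSpace s = ∀ t → wkHead (run t) < s

Decides : TM → Pred (List Bool) 0ℓ → Set
Decides M ℒ = ∀ w → Halts M w × (w ∈ ℒ ⇔ Accepts M w)

-- suc makes the bound usable for inputs of length at most one.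
LogSpace : TM → Set
LogSpace M = ∃[ c ] ∀ w → InSpace M w (c * suc ⌈log₂ length w ⌉)

L : Pred (Pred (List Bool) 0ℓ) 0ℓ
L ℒ = ∃[ M ] LogSpace M × Decides M ℒ

------------------------------------------------------------------------
-- L as a class of problems on structures

-- Immerman's bin(𝔄): the characteristic strings of the relations followed
-- by the constants in binary with ⌈log₂ n⌉ bits each.  If there are no
-- relations, a unary empty relation is added, so that the length of the
-- encoding is always at least n.
bin : ∀ {σ} → Structure σ → List Bool
bin {σ} 𝔄 = relations (#rel σ) ++ concatMap constant (allFin (#con σ))
  where
  relation : Fin (#rel σ) → List Bool
  relation R = List.map (rel 𝔄 R) (tuples (size 𝔄) (arity σ R))

  relations : ℕ → List Bool
  relations zero    = replicate (size 𝔄) false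
  relations (suc _) = concatMap relation (allFin (#rel σ))

  constant : Fin (#con σ) → List Bool
  constant c = applyDownFrom (bit (toℕ (con 𝔄 c))) ⌈log₂ size 𝔄 ⌉

-- Membership in ℒ matters only on encodings; since the set of encodings
-- is itself in L, this is the same as { bin 𝔄 ∣ 𝔄 ∈ P } being in L.
InL : ∀ {σ} → Problem σ 0ℓ → Set₁
InL P = ∃[ ℒ ] ℒ ∈ L × (∀ 𝔄 → 𝔄 ∈ P ⇔ bin 𝔄 ∈ ℒ)

L-hard : ∀ {τ ℓ} → Problem τ ℓ → Set _
L-hard Q = ∀ {σ} (P : Problem σ 0ℓ) → InL P → P ≤fo Q

------------------------------------------------------------------------
-- Model checking for teams with domain {x,y}

teamVocabulary : Vocabulary
teamVocabulary = record
  { #rel = 1 ; arity = λ _ → 2 ; arity-pos = λ _ → _ ; #con = 0 }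

pairs : (𝔄 : Structure teamVocabulary) → Pred (Universe 𝔄 × Universe 𝔄) 0ℓ
pairs 𝔄 (a , b) = T (rel 𝔄 zero (a ∷ b ∷ []))

-- For distinct x, y exhausting X, the structure 𝔄 encodes exactly one team
-- with domain X and range the universe of 𝔄, up to pointwise equality of
-- assignments (which ⊨ respects).
MC : {X : Set} → X → X → TeamFormula X → Problem teamVocabulary (lsuc 0ℓ)
MC {X} x y φ 𝔄 =
  Σ[ S ∈ Team X (Universe 𝔄) ] Rel x y S ≐ pairs 𝔄 × S ⊨ φ

{-# OPTIONS --safe #-}

-- Reduce acceptance by a logarithmic space machine M to the existence of an
-- orientation.  The relation Rel(T) is a bipartite graph whose two sides are
-- copies of the universe, and T satisfies dep(x,y) ∨ dep(y,x) iff each edge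
-- (a , b) can be charged to a on the left or to b on the right so that no
-- vertex is charged twice, i.e. iff no component has more edges than vertices.
--
-- On the configurations of M take the edges (c , c) and (next c , c), where a
-- rejecting configuration is followed by a new vertex s in front of the
-- initial one, and an accepting configuration by nothing.  Charging (c , c) on
-- the left and (next c , c) on the right uses up every vertex except for the
-- right copies of accepting configurations.  A further edge (d , s), where d
-- is another new vertex followed by s, is added to the component of s.
-- If M accepts, the charges can be shifted along the computation to its end;
-- if M rejects, the component of s is closed and has one edge too many.
--
-- For first-order definability a configuration is a tuple of elements.  The
-- input head is a place in the lexicographically ordered list of the bits of
-- bin 𝔄, so that its moves are definable from the order.  The work tape has
-- O(log n) cells; for each symbol, it is a constant number of elements whose
-- binary digits say which cells hold the symbol, so that BIT reads and
-- rewrites it.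
module Submission where

open import Data.Bool.Base using (Bool; true; false; T; if_then_else_)
open import Data.Bool.Properties as Bool using (T-≡; ¬-not; not-¬)
open import Data.Empty using (⊥)
open import Data.Fin.Base as Fin using (Fin; zero; suc; toℕ; fromℕ<; _↑ˡ_; _↑ʳ_)
import Data.Fin.Properties as Fin
open import Data.List.Base as List
  using (List; []; _∷_; _++_; [_]; length; concatMap; allFin; cartesianProductWith;
         applyDownFrom; replicate)
import Data.List.Properties as List
open import Data.List.Membership.Propositional using (_∈_)
open import Data.List.Membership.Propositional.Properties
open import Data.List.Relation.Unary.All as All using (All; []; _∷_)
import Data.List.Relation.Unary.All.Properties as All
open import Data.List.Relation.Unary.AllPairs as AllPairs using (AllPairs; []; _∷_)
import Data.List.Relation.Unary.AllPairs.Properties as AllPairs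
open import Data.List.Relation.Unary.Any as Any using (here; there)
import Data.List.Relation.Unary.Any.Properties as Any
open import Data.Maybe.Base using (Maybe; just; nothing)
open import Data.Nat.Base hiding (_≤′_; parity)
open import Data.Nat.DivMod
open import Data.Nat.Divisibility.Core using (divides-refl)
open import Data.Nat.Induction using (<-wellFounded)
open import Data.Nat.Logarithm using (⌈log₂_⌉; ⌈log₂⌉-mono-≤; ⌈log₂2^n⌉≡n)
open import Data.Nat.Logarithm.Core using (⌈log2⌉)
open import Data.Nat.Properties hiding (_≟_)
open import Data.Product.Base using (∃-syntax; _×_; _,_; proj₁; proj₂)
open import Data.Product.Properties using (≡-dec)
open import Data.Sum.Base as Sum using (_⊎_; inj₁; inj₂; [_,_]′)
open import Data.Unit.Base using (⊤; tt)
open import Data.Vec.Base as Vec using (Vec; []; _∷_)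
import Data.Vec.Properties as Vec
open import Defs
open import Function.Base using (_∘_; id)
open import Function.Bundles using (_⇔_; mk⇔; Equivalence)
open import Induction.WellFounded using (Acc; acc)
open import Level using (lift)
open import Relation.Binary.Definitions using (DecidableEquality; tri<; tri≈; tri>)
open import Relation.Binary.PropositionalEquality hiding ([_])
open import Relation.Nullary.Decidable using (Dec; yes; no; does; map′; dec-true; dec-false)
open import Relation.Nullary.Negation using (¬_; contradiction)

open Equivalence

-- Binary digits and logarithms

bit-zero : ∀ a → bit a 0 ≡ (a % 2 ≡ᵇ 1)
bit-zero a = cong (λ m → m % 2 ≡ᵇ 1) (n/1≡n a)

bit-suc : ∀ a i → bit a (suc i) ≡ bit (a / 2) i
bit-suc a i = cong (λ m → m % 2 ≡ᵇ 1) (sym (m/n/o≡m/[n*o] a 2 (2 ^ i)))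
  where instance
    _ = m^n≢0 2 i
    _ = m^n≢0 2 (suc i)

bit-0 : ∀ i → bit 0 i ≡ false
bit-0 zero    = refl
bit-0 (suc i) = trans (bit-suc 0 i) (bit-0 i)

bitValue : Bool → ℕ
bitValue true  = 1
bitValue false = 0

fromBits : (ℕ → Bool) → ℕ → ℕ
fromBits g zero    = 0
fromBits g (suc k) = bitValue (g 0) + fromBits (g ∘ suc) k * 2

bitValue+m*2/2 : ∀ b m → (bitValue b + m * 2) / 2 ≡ m
bitValue+m*2/2 b m = trans (+-distrib-/-∣ʳ (bitValue b) (divides-refl m))
  (cong₂ _+_ (lemma b) (m*n/n≡m m 2))
  where
  lemma : ∀ b → bitValue b / 2 ≡ 0
  lemma true  = refl
  lemma false = refl

bitValue+m*2%2 : ∀ b m → ((bitValue b + m * 2) % 2 ≡ᵇ 1) ≡ b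
bitValue+m*2%2 b m = trans (cong (_≡ᵇ 1) ([m+kn]%n≡m%n (bitValue b) m 2)) (lemma b)
  where
  lemma : ∀ b → (bitValue b % 2 ≡ᵇ 1) ≡ b
  lemma true  = refl
  lemma false = refl

fromBits<2^k : ∀ g k → fromBits g k < 2 ^ k
fromBits<2^k g zero    = z<s
fromBits<2^k g (suc k) = begin-strict
  bitValue (g 0) + m * 2 <⟨ +-monoˡ-< (m * 2) (bitValue<2 (g 0)) ⟩
  suc m * 2              ≤⟨ *-monoˡ-≤ 2 (fromBits<2^k (g ∘ suc) k) ⟩
  2 ^ k * 2              ≡⟨ *-comm (2 ^ k) 2 ⟩
  2 ^ suc k              ∎
  where
  open ≤-Reasoning
  m = fromBits (g ∘ suc) k
  bitValue<2 : ∀ b → bitValue b < 2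
  bitValue<2 true  = s<s z<s
  bitValue<2 false = z<s

bit-fromBits : ∀ g k {i} → i < k → bit (fromBits g k) i ≡ g i
bit-fromBits g (suc k) {zero}  _ =
  trans (bit-zero (fromBits g (suc k))) (bitValue+m*2%2 (g 0) (fromBits (g ∘ suc) k))
bit-fromBits g (suc k) {suc i} (s≤s i<k) =
  trans (bit-suc (fromBits g (suc k)) i)
    (trans (cong (λ m → bit m i) (bitValue+m*2/2 (g 0) (fromBits (g ∘ suc) k)))
      (bit-fromBits (g ∘ suc) k i<k))

bit-beyond : ∀ g k {i} → k ≤ i → bit (fromBits g k) i ≡ false
bit-beyond g zero    {i}     _         = bit-0 i
bit-beyond g (suc k) {suc i} (s≤s k≤i) =
  trans (bit-suc (fromBits g (suc k)) i)
    (trans (cong (λ m → bit m i) (bitValue+m*2/2 (g 0) (fromBits (g ∘ suc) k)))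
      (bit-beyond (g ∘ suc) k k≤i))

bit-2^ : ∀ p q → bit (2 ^ p) q ≡ (q ≡ᵇ p)
bit-2^ zero    zero    = refl
bit-2^ zero    (suc q) = trans (bit-suc 1 q) (bit-0 q)
bit-2^ (suc p) zero    = trans (bit-zero (2 ^ suc p))
  (cong (_≡ᵇ 1) (trans (cong (_% 2) (*-comm 2 (2 ^ p))) (m*n%n≡0 (2 ^ p) 2)))
bit-2^ (suc p) (suc q) = trans (bit-suc (2 ^ suc p) q)
  (trans (cong (λ m → bit m q) (trans (cong (_/ 2) (*-comm 2 (2 ^ p))) (m*n/n≡m (2 ^ p) 2)))
    (bit-2^ p q))

bit-injective : ∀ k {a b} → a < 2 ^ k → b < 2 ^ k →
  (∀ i → i < k → bit a i ≡ bit b i) → a ≡ b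
bit-injective zero    {zero} {zero} _ _ _ = refl
bit-injective zero    {suc _} (s≤s ())
bit-injective zero    {zero} {suc _} _ (s≤s ())
bit-injective (suc k) {a} {b} a< b< eq = begin
  a                   ≡⟨ m≡m%n+[m/n]*n a 2 ⟩
  a % 2 + (a / 2) * 2 ≡⟨ cong₂ (λ r q → r + q * 2) parities halves ⟩
  b % 2 + (b / 2) * 2 ≡⟨ m≡m%n+[m/n]*n b 2 ⟨
  b                   ∎
  where
  open ≡-Reasoning
  half< : ∀ {c} → c < 2 ^ suc k → c / 2 < 2 ^ k
  half< {c} c< = m<n*o⇒m/o<n (subst (c <_) (*-comm 2 (2 ^ k)) c<)
  halves : a / 2 ≡ b / 2
  halves = bit-injective k (half< a<) (half< b<) λ i i<k →
    trans (sym (bit-suc a i)) (trans (eq (suc i) (s<s i<k)) (bit-suc b i))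
  <2 : ∀ {m n} → m < 2 → n < 2 → (m ≡ᵇ 1) ≡ (n ≡ᵇ 1) → m ≡ n
  <2 {0} {0} _ _ _ = refl
  <2 {1} {1} _ _ _ = refl
  <2 {suc (suc _)} (s≤s (s≤s ()))
  <2 {0} {suc (suc _)} _ (s≤s (s≤s ()))
  <2 {1} {suc (suc _)} _ (s≤s (s≤s ()))
  parities : a % 2 ≡ b % 2
  parities = <2 (m%n<n a 2) (m%n<n b 2)
    (trans (sym (bit-zero a)) (trans (eq 0 z<s) (bit-zero b)))

n<2^n : ∀ n → n < 2 ^ n
n<2^n zero    = z<s
n<2^n (suc n) = begin-strict
  suc n         <⟨ s<s (n<2^n n) ⟩
  1 + 2 ^ n     ≤⟨ +-monoˡ-≤ (2 ^ n) (m^n>0 2 n) ⟩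
  2 ^ n + 2 ^ n ≡⟨ cong (2 ^ n +_) (+-identityʳ (2 ^ n)) ⟨
  2 ^ suc n     ∎
  where open ≤-Reasoning

n≤2^⌈log₂n⌉ : ∀ n → n ≤ 2 ^ ⌈log₂ n ⌉
n≤2^⌈log₂n⌉ n = go n (<-wellFounded n)
  where
  open ≤-Reasoning
  -- The accessibility proof is a variable because `⌈log2⌉` recurses on it, so that `go` can follow
  -- that recursion.
  go : ∀ n (a : Acc _<_ n) → n ≤ 2 ^ ⌈log2⌉ n a
  go 0 _ = z≤n
  go 1 _ = ≤-refl
  go (suc (suc n)) (acc rs) = begin
    suc (suc n)                       ≡⟨ cong (2 +_) (⌊n/2⌋+⌈n/2⌉≡n n) ⟨
    suc (suc (⌊ n /2⌋ + ⌈ n /2⌉))     ≤⟨ s≤s (s≤s (+-monoˡ-≤ ⌈ n /2⌉ (⌊n/2⌋≤⌈n/2⌉ n))) ⟩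
    suc (suc (⌈ n /2⌉ + ⌈ n /2⌉))     ≡⟨ cong suc (+-suc ⌈ n /2⌉ ⌈ n /2⌉) ⟨
    suc ⌈ n /2⌉ + suc ⌈ n /2⌉         ≡⟨ cong (suc ⌈ n /2⌉ +_) (+-identityʳ (suc ⌈ n /2⌉)) ⟨
    2 * suc ⌈ n /2⌉                   ≤⟨ *-monoʳ-≤ 2 (go (suc ⌈ n /2⌉) _) ⟩
    2 * 2 ^ ⌈log2⌉ (suc ⌈ n /2⌉) _    ∎

-- The adjunction between exponential and logarithm. It removes the logarithm: `2 ^ p < n` says that
-- `2 ^ p` is an element of a structure of size `n`, which is first-order expressible.
p<⌈log₂n⌉⇔2^p<n : ∀ p n → p < ⌈log₂ n ⌉ ⇔ 2 ^ p < n
p<⌈log₂n⌉⇔2^p<n p n = mk⇔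
  (λ p< → ≰⇒> λ n≤ → <⇒≱ p< (subst (⌈log₂ n ⌉ ≤_) (⌈log₂2^n⌉≡n p) (⌈log₂⌉-mono-≤ n≤)))
  (λ 2^p< → ≰⇒> λ log≤ → <⇒≱ 2^p< (≤-trans (n≤2^⌈log₂n⌉ n) (^-monoʳ-≤ 2 log≤)))

⌈log₂n^k⌉≤k*⌈log₂n⌉ : ∀ n k → ⌈log₂ n ^ k ⌉ ≤ k * ⌈log₂ n ⌉
⌈log₂n^k⌉≤k*⌈log₂n⌉ n k = begin
  ⌈log₂ n ^ k ⌉                ≤⟨ ⌈log₂⌉-mono-≤ (^-monoˡ-≤ k (n≤2^⌈log₂n⌉ n)) ⟩
  ⌈log₂ (2 ^ ⌈log₂ n ⌉) ^ k ⌉  ≡⟨ cong ⌈log₂_⌉ (^-*-assoc 2 ⌈log₂ n ⌉ k) ⟩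
  ⌈log₂ 2 ^ (⌈log₂ n ⌉ * k) ⌉  ≡⟨ ⌈log₂2^n⌉≡n (⌈log₂ n ⌉ * k) ⟩
  ⌈log₂ n ⌉ * k                ≡⟨ *-comm ⌈log₂ n ⌉ k ⟩
  k * ⌈log₂ n ⌉                ∎
  where open ≤-Reasoning

-- Orientations of functional graphs

module _ {V : Set} where

  -- Every pair is charged to its first component or to its second one, and
  -- every vertex of either side is charged at most once.
  record Orientable (E : V → V → Set) : Set₁ where
    field
      E₁ E₂       : V → V → Set
      cover       : ∀ {a b} → E a b → E₁ a b ⊎ E₂ a b
      functional₁ : ∀ {a b b′} → E₁ a b → E₁ a b′ → b ≡ b′
      functional₂ : ∀ {a a′ b} → E₂ a b → E₂ a′ b → a ≡ a′

  data Edge (Next : V → V → Set) (d s : V) : V → V → Set where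
    loop  : ∀ {a} → Edge Next d s a a
    next  : ∀ {a b} → Next b a → Edge Next d s a b
    chord : Edge Next d s d s

module _ {V : Set} (Next : V → V → Set)
         (next-functional : ∀ {a b b′} → Next a b → Next a b′ → b ≡ b′)
         (d : V) (p : ℕ → V) (m : ℕ) (p-next : ∀ {t} → t < m → Next (p t) (p (suc t))) where

  -- The default charges send `(c , c)` to the left and `(next c , c)` to the right. Along the path
  -- they are exchanged: `(p (suc t) , p t)` goes to the left and the loop at `p (suc t)` to the
  -- right. The right copy of `p m`, free by default as `p m` is final, absorbs the shift, and the
  -- right copy of `p 0` is free for the chord.
  orientable : DecidableEquality V → (∀ {a} → ¬ Next (p m) a) →
    Orientable (Edge Next d (p 0))
  orientable _≟_ final = record
    { E₁          = E₁
    ; E₂          = E₂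
    ; cover       = cover
    ; functional₁ = functional₁
    ; functional₂ = functional₂
    }
    where
    -- If p s = p t then p (s + k) = p (t + k), which for t + k = m is final.
    shift : ∀ {s t} k → t + k ≤ m → s ≤ t → p s ≡ p t → p (s + k) ≡ p (t + k)
    shift {s} {t} zero    _ _ eq rewrite +-identityʳ s | +-identityʳ t = eq
    shift {s} {t} (suc k) le s≤t eq rewrite +-suc s k | +-suc t k =
      next-functional (p-next (<-≤-trans (s≤s (+-monoˡ-≤ k s≤t)) le))
        (subst (λ v → Next v (p (suc (t + k)))) (sym (shift k (<⇒≤ le) s≤t eq)) (p-next le))

    -- Carried on by `shift`, a repetition would make `p m` equal to an earlier vertex of the path,
    -- which has a successor.
    distinct : ∀ {s t} → s < t → t ≤ m → p s ≢ p t
    distinct {s} {t} s<t t≤m eq = final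
      (subst (λ v → Next v (p (suc (s + (m ∸ t)))))
        (trans (shift (m ∸ t) (≤-reflexive (m+[n∸m]≡n t≤m)) (<⇒≤ s<t) eq) (cong p (m+[n∸m]≡n t≤m)))
        (p-next (<-≤-trans (+-monoˡ-< (m ∸ t) s<t) (≤-reflexive (m+[n∸m]≡n t≤m)))))

    p-injective : ∀ {s t} → s ≤ m → t ≤ m → p s ≡ p t → s ≡ t
    p-injective {s} {t} s≤m t≤m eq = ≤-antisym
      (≮⇒≥ λ t<s → distinct t<s s≤m (sym eq)) (≮⇒≥ λ s<t → distinct s<t t≤m eq)

    OnPath : V → Set
    OnPath v = ∃[ t ] t < suc m × v ≡ p t

    AfterStart : V → Set
    AfterStart v = ∃[ t ] t < m × v ≡ p (suc t)

    onPath? : ∀ v → Dec (OnPath v)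
    onPath? v = anyUpTo? (λ t → v ≟ p t) (suc m)

    afterStart? : ∀ v → Dec (AfterStart v)
    afterStart? v = anyUpTo? (λ t → v ≟ p (suc t)) m

    E₁ E₂ : V → V → Set
    E₁ a b = (a ≡ b × ¬ AfterStart a) ⊎ (∃[ t ] t < m × a ≡ p (suc t) × b ≡ p t)
    E₂ a b = (Next b a × ¬ OnPath b) ⊎ (a ≡ b × AfterStart b) ⊎ (a ≡ d × b ≡ p 0)

    cover : ∀ {a b} → Edge Next d (p 0) a b → E₁ a b ⊎ E₂ a b
    cover {a} loop with afterStart? a
    ... | yes after = inj₂ (inj₂ (inj₁ (refl , after)))
    ... | no ¬after = inj₁ (inj₁ (refl , ¬after))
    cover {a} {b} (next ba) with onPath? b
    ... | no ¬on = inj₂ (inj₁ (ba , ¬on))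
    ... | yes (t , s≤s t≤m , refl) with m≤n⇒m<n∨m≡n t≤m
    ...   | inj₁ t<m  = inj₁ (inj₂ (t , t<m , next-functional ba (p-next t<m) , refl))
    ...   | inj₂ refl = contradiction ba final
    cover chord = inj₂ (inj₂ (inj₂ (refl , refl)))

    functional₁ : ∀ {a b b′} → E₁ a b → E₁ a b′ → b ≡ b′
    functional₁ (inj₁ (refl , _)) (inj₁ (refl , _)) = refl
    functional₁ (inj₁ (_ , ¬after)) (inj₂ (t , t<m , a≡ , _)) = contradiction (t , t<m , a≡) ¬after
    functional₁ (inj₂ (t , t<m , a≡ , _)) (inj₁ (_ , ¬after)) = contradiction (t , t<m , a≡) ¬after
    functional₁ (inj₂ (s , s<m , refl , refl)) (inj₂ (t , t<m , a≡ , refl)) =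
      cong p (suc-injective (p-injective s<m t<m a≡))

    onPath-after : ∀ {v} → AfterStart v → OnPath v
    onPath-after (t , t<m , eq) = suc t , s≤s t<m , eq

    start≢after : ∀ {v} → v ≡ p 0 → ¬ AfterStart v
    start≢after refl (t , t<m , eq) = distinct z<s t<m eq

    functional₂ : ∀ {a a′ b} → E₂ a b → E₂ a′ b → a ≡ a′
    functional₂ (inj₁ (n , _)) (inj₁ (n′ , _)) = next-functional n n′
    functional₂ (inj₁ (_ , off)) (inj₂ (inj₁ (_ , after))) = contradiction (onPath-after after) off
    functional₂ (inj₁ (_ , off)) (inj₂ (inj₂ (_ , eq))) = contradiction (0 , z<s , eq) off
    functional₂ (inj₂ (inj₁ (_ , after))) (inj₁ (_ , off)) = contradiction (onPath-after after) off
    functional₂ (inj₂ (inj₁ (refl , _))) (inj₂ (inj₁ (refl , _))) = refl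
    functional₂ (inj₂ (inj₁ (_ , after))) (inj₂ (inj₂ (_ , eq))) = contradiction after (start≢after eq)
    functional₂ (inj₂ (inj₂ (_ , eq))) (inj₁ (_ , off)) = contradiction (0 , z<s , eq) off
    functional₂ (inj₂ (inj₂ (_ , eq))) (inj₂ (inj₁ (_ , after))) = contradiction after (start≢after eq)
    functional₂ (inj₂ (inj₂ (refl , _))) (inj₂ (inj₂ (refl , _))) = refl

  -- Counting edges would require the vertices of the path to be shown distinct first. Instead the
  -- charge of the loop at `p 0` is propagated: either choice forces charges all around the cycle
  -- until some vertex is charged twice.
  ¬orientable : 0 < m → Next (p m) (p 0) → Next d (p 0) → (∀ t → p 0 ≢ p (suc t)) →
    (∀ t → d ≢ p t) → ¬ Orientable (Edge Next d (p 0))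
  ¬orientable 0<m back d-next p0≢ d≢p O = [ case₁ , case₂ ]′ (cover loop)
    where
    open Orientable O

    instance
      m-nonZero : NonZero m
      m-nonZero = >-nonZero 0<m

    atEnd : ∀ {P : ℕ → Set} → (∀ t → t < m → P (suc t)) → P m
    atEnd {P} f = subst P (suc-pred m) (f (pred m) (≤-reflexive (suc-pred m)))

    -- If the path stood still once, it would stand still up to `p m`; the successor `p 0` of `p m`
    -- would then also be `p (suc t)`, but `p 0` does not recur.
    p-steps : ∀ {t} → t < m → p t ≢ p (suc t)
    p-steps {t} t<m eq = p0≢ t (next-functional
      (subst (λ v → Next v (p 0)) pm≡pt back) (p-next t<m))
      where
      stays : ∀ k → t + k ≤ m → p (t + k) ≡ p t
      stays zero    _  = cong p (+-identityʳ t)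
      stays (suc k) le rewrite +-suc t k =
        trans (next-functional (subst (λ v → Next v (p (suc (t + k)))) (stays k (<⇒≤ le)) (p-next le))
                 (p-next t<m))
              (sym eq)
      t+[m∸t]≡m = m+[n∸m]≡n (<⇒≤ t<m)
      pm≡pt : p m ≡ p t
      pm≡pt = trans (cong p (sym t+[m∸t]≡m)) (stays (m ∸ t) (≤-reflexive t+[m∸t]≡m))

    p0≢pm : p 0 ≢ p m
    p0≢pm = atEnd {λ t → p 0 ≢ p t} (λ t _ → p0≢ t)

    -- An edge sharing its first (second) endpoint with an edge charged there
    -- is charged to the other endpoint.
    not₁ : ∀ {a b b′} → E₁ a b → b ≢ b′ → Edge Next d (p 0) a b′ → E₂ a b′
    not₁ ab b≢ e = [ (λ ab′ → contradiction (functional₁ ab ab′) b≢) , (λ x → x) ]′ (cover e)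

    not₂ : ∀ {a a′ b} → E₂ a b → a ≢ a′ → Edge Next d (p 0) a′ b → E₁ a′ b
    not₂ ab a≢ e = [ (λ x → x) , (λ a′b → contradiction (functional₂ ab a′b) a≢) ]′ (cover e)

    -- A loop charged on the right pushes the following path edge to the left, which pushes the next
    -- loop to the right.
    forwards : E₂ (p 1) (p 1) → ∀ t → t < m → E₂ (p (suc t)) (p (suc t))
    forwards e zero    _  = e
    forwards e (suc t) le = not₁
      (not₂ (forwards e t (<⇒≤ le)) (p-steps le) (next (p-next le)))
      (p-steps le) loop

    -- A loop charged on the left pushes the edge to its predecessor to the right, which pushes the
    -- loop of the predecessor to the left, down to the edge `(p 1 , p 0)`.
    backwards : ∀ t → t < m → E₁ (p (suc t)) (p (suc t)) → E₂ (p 1) (p 0)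
    backwards zero    lt e = not₁ e (≢-sym (p-steps lt)) (next (p-next lt))
    backwards (suc t) lt e = backwards t (<⇒≤ lt)
      (not₂ (not₁ e (≢-sym (p-steps lt)) (next (p-next lt))) (≢-sym (p-steps lt)) loop)

    -- The forced charges run through `(p 0 , d)`, the loop at `d`, the chord, `(p 1 , p 0)` and
    -- then forwards along the path; the last one, of `(p 0 , p m)`, needs the left copy of `p 0`
    -- again.
    case₁ : ¬ E₁ (p 0) (p 0)
    case₁ e₀ = p0≢pm (functional₁ e₀ (not₂ eₘ (≢-sym p0≢pm) (next back)))
      where
      e₁ = not₁ e₀ (≢-sym (d≢p 0)) (next d-next)
      e₂ = not₂ e₁ (≢-sym (d≢p 0)) loop
      e₃ = not₁ e₂ (d≢p 0) chord
      e₄ = not₂ e₃ (d≢p 1) (next (p-next 0<m))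
      e₅ = not₁ e₄ (p-steps 0<m) loop
      eₘ : E₂ (p m) (p m)
      eₘ = atEnd {λ t → E₂ (p t) (p t)} (forwards e₅)

    -- Here the order is the chord, the loop at `d`, `(p 0 , d)`, `(p 0 , p m)` and then backwards
    -- along the path, until `(p 1 , p 0)` needs the right copy of `p 0` again.
    case₂ : ¬ E₂ (p 0) (p 0)
    case₂ e₀ = p0≢ 0 (functional₂ e₀ (atEnd {λ t → E₁ (p t) (p t) → E₂ (p 1) (p 0)} backwards eₘ))
      where
      e₁ = not₂ e₀ (≢-sym (d≢p 0)) chord
      e₂ = not₁ e₁ (≢-sym (d≢p 0)) loop
      e₃ = not₂ e₂ (d≢p 0) (next d-next)
      e₄ = not₁ e₃ (d≢p m) (next back)
      eₘ = not₂ e₄ p0≢pm loop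

-- Definable relations

infixr 5 _⊗_

-- Nested shapes rather than lengths, so that components of tuples of elements or terms are reached
-- by pattern matching; `toVec` and `fromVec` pass to flat vectors for blocks of quantifiers and for
-- queries.
data Sort : Set where
  𝟙 el : Sort
  _⊗_  : Sort → Sort → Sort

Tuple : Sort → Set → Set
Tuple 𝟙       A = ⊤
Tuple el      A = A
Tuple (s ⊗ t) A = Tuple s A × Tuple t A

width : Sort → ℕ
width 𝟙       = 0
width el      = 1
width (s ⊗ t) = width s + width t

pow : ℕ → Sort → Sort
pow zero    s = 𝟙
pow (suc k) s = s ⊗ pow k s

mapₛ : ∀ {A B} s → (A → B) → Tuple s A → Tuple s B
mapₛ 𝟙       f x       = tt
mapₛ el      f x       = f x
mapₛ (s ⊗ t) f (x , y) = mapₛ s f x , mapₛ t f y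

mapₛ-∘ : ∀ {A B C} s (g : B → C) (f : A → B) x → mapₛ s g (mapₛ s f x) ≡ mapₛ s (g ∘ f) x
mapₛ-∘ 𝟙       g f x       = refl
mapₛ-∘ el      g f x       = refl
mapₛ-∘ (s ⊗ t) g f (x , y) = cong₂ _,_ (mapₛ-∘ s g f x) (mapₛ-∘ t g f y)

mapₛ-cong : ∀ {A B} s {f g : A → B} → (∀ a → f a ≡ g a) → ∀ x → mapₛ s f x ≡ mapₛ s g x
mapₛ-cong 𝟙       eq x       = refl
mapₛ-cong el      eq x       = eq x
mapₛ-cong (s ⊗ t) eq (x , y) = cong₂ _,_ (mapₛ-cong s eq x) (mapₛ-cong t eq y)

toVec : ∀ {A} s → Tuple s A → Vec A (width s)
toVec 𝟙       x       = []
toVec el      x       = x ∷ []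
toVec (s ⊗ t) (x , y) = toVec s x Vec.++ toVec t y

fromVec : ∀ {A} s → Vec A (width s) → Tuple s A
fromVec 𝟙       v = tt
fromVec el      v = Vec.head v
fromVec (s ⊗ t) v = fromVec s (Vec.take (width s) v) , fromVec t (Vec.drop (width s) v)

fromVec-toVec : ∀ {A} s (x : Tuple s A) → fromVec s (toVec s x) ≡ x
fromVec-toVec 𝟙       x       = refl
fromVec-toVec el      x       = refl
fromVec-toVec (s ⊗ t) (x , y) =
  let take≡ , drop≡ = Vec.++-injective _ (toVec s x)
                        (Vec.take++drop≡id (width s) (toVec s x Vec.++ toVec t y))
  in cong₂ _,_ (trans (cong (fromVec s) take≡) (fromVec-toVec s x))
               (trans (cong (fromVec t) drop≡) (fromVec-toVec t y))

toVec-fromVec : ∀ {A} s (v : Vec A (width s)) → toVec s (fromVec s v) ≡ v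
toVec-fromVec 𝟙       []       = refl
toVec-fromVec el      (a ∷ []) = refl
toVec-fromVec (s ⊗ t) v        = trans
  (cong₂ Vec._++_ (toVec-fromVec s _) (toVec-fromVec t _)) (Vec.take++drop≡id (width s) v)

mapₛ-fromVec : ∀ {A B} s (f : A → B) v → mapₛ s f (fromVec s v) ≡ fromVec s (Vec.map f v)
mapₛ-fromVec 𝟙       f v       = refl
mapₛ-fromVec el      f (a ∷ v) = refl
mapₛ-fromVec (s ⊗ t) f v       = cong₂ _,_
  (trans (mapₛ-fromVec s f _) (cong (fromVec s) (sym (Vec.take-map f (width s) v))))
  (trans (mapₛ-fromVec t f _) (cong (fromVec t) (sym (Vec.drop-map f (width s) v))))

_≟ₛ_ : ∀ {n s} → DecidableEquality (Tuple s (Fin n))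
_≟ₛ_ {s = 𝟙}     x y = yes refl
_≟ₛ_ {s = el}    x y = x Fin.≟ y
_≟ₛ_ {s = s ⊗ t} x y = ≡-dec (_≟ₛ_ {s = s}) (_≟ₛ_ {s = t}) x y

Lex : ∀ {n} s → Tuple s (Fin n) → Tuple s (Fin n) → Set
Lex 𝟙       x       y         = ⊥
Lex el      x       y         = x Fin.< y
Lex (s ⊗ t) (x , y) (x′ , y′) = Lex s x x′ ⊎ (x ≡ x′ × Lex t y y′)

Lex-asym : ∀ {n} s {x y : Tuple s (Fin n)} → Lex s x y → ¬ Lex s y x
Lex-asym el      x<y                x>y                = <-asym x<y x>y
Lex-asym (s ⊗ t) (inj₁ x<y)         (inj₁ x>y)         = Lex-asym s x<y x>y
Lex-asym (s ⊗ t) (inj₁ x<y)         (inj₂ (refl , _))  = Lex-asym s x<y x<y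
Lex-asym (s ⊗ t) (inj₂ (refl , _))  (inj₁ x>y)         = Lex-asym s x>y x>y
Lex-asym (s ⊗ t) (inj₂ (_ , x<y))   (inj₂ (_ , x>y))   = Lex-asym t x<y x>y

Lex-irrefl : ∀ {n} s {x : Tuple s (Fin n)} → ¬ Lex s x x
Lex-irrefl s x<x = Lex-asym s x<x x<x

lookupₛ : ∀ {A k} s → Fin k → Tuple (pow k s) A → Tuple s A
lookupₛ s zero    (x , _) = x
lookupₛ s (suc i) (_ , y) = lookupₛ s i y

mapₛ-lookupₛ : ∀ {A B k} s (i : Fin k) (f : A → B) x →
  mapₛ s f (lookupₛ s i x) ≡ lookupₛ s i (mapₛ (pow k s) f x)
mapₛ-lookupₛ s zero    f x       = refl
mapₛ-lookupₛ s (suc i) f (_ , y) = mapₛ-lookupₛ s i f y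

tabulateₛ : ∀ {A k} s → (Fin k → Tuple s A) → Tuple (pow k s) A
tabulateₛ {k = zero}  s f = tt
tabulateₛ {k = suc k} s f = f zero , tabulateₛ s (f ∘ suc)

lookupₛ-tabulateₛ : ∀ {A k} s (f : Fin k → Tuple s A) i → lookupₛ s i (tabulateₛ s f) ≡ f i
lookupₛ-tabulateₛ s f zero    = refl
lookupₛ-tabulateₛ s f (suc i) = lookupₛ-tabulateₛ s (f ∘ suc) i

lookupₛ-ext : ∀ {A} k s {x y : Tuple (pow k s) A} →
  (∀ (i : Fin k) → lookupₛ {A} s i x ≡ lookupₛ s i y) → x ≡ y
lookupₛ-ext zero    s eq = refl
lookupₛ-ext (suc k) s eq = cong₂ _,_ (eq zero) (lookupₛ-ext k s (eq ∘ suc))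

module _ {σ : Vocabulary} where

  Val : Sort → Structure σ → Set
  Val s 𝔄 = Tuple s (Universe 𝔄)

  minᵤ oneᵤ maxᵤ : ∀ 𝔄 → Universe {σ} 𝔄
  minᵤ 𝔄 = ⟦ 𝔄 ⟧ {0} min′ []
  oneᵤ 𝔄 = ⟦ 𝔄 ⟧ {0} one′ []
  maxᵤ 𝔄 = ⟦ 𝔄 ⟧ {0} max′ []

  eval : ∀ 𝔄 {m} → Vec (Universe 𝔄) m → ∀ s → Tuple s (Term σ m) → Val s 𝔄
  eval 𝔄 ρ s = mapₛ s (λ t → ⟦ 𝔄 ⟧ t ρ)

  -- The formula is abstracted over the terms to be put for its variables, so
  -- that substitution into definable relations needs no renaming of formulas.
  record Definable (s : Sort) (Q : ∀ 𝔄 → Val s 𝔄 → Set) : Set where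
    field
      formula : ∀ {m} → Tuple s (Term σ m) → Formula σ m
      correct : ∀ 𝔄 {m} (ρ : Vec (Universe 𝔄) m) ts →
        Sat 𝔄 (formula ts) ρ ⇔ Q 𝔄 (eval 𝔄 ρ s ts)

  open Definable public

  variables : ∀ k {m} → Vec (Term σ (k + m)) k
  variables k {m} = Vec.tabulate (λ i → var (i ↑ˡ m))

  weaken : ∀ k {m} → Term σ m → Term σ (k + m)
  weaken k (var i)  = var (k ↑ʳ i)
  weaken k (con′ c) = con′ c
  weaken k min′     = min′
  weaken k one′     = one′
  weaken k max′     = max′

  module _ (𝔄 : Structure σ) where

    map-variables : ∀ {k m} (v : Vec (Universe 𝔄) k) (ρ : Vec (Universe 𝔄) m) →
      Vec.map (λ t → ⟦ 𝔄 ⟧ t (v Vec.++ ρ)) (variables k) ≡ v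
    map-variables v ρ = trans (sym (Vec.tabulate-∘ _ _))
      (trans (Vec.tabulate-cong (λ i → Vec.lookup-++ˡ v ρ i)) (Vec.tabulate∘lookup v))

    ⟦weaken⟧ : ∀ {k m} (v : Vec (Universe 𝔄) k) (ρ : Vec (Universe 𝔄) m) t →
      ⟦ 𝔄 ⟧ (weaken k t) (v Vec.++ ρ) ≡ ⟦ 𝔄 ⟧ t ρ
    ⟦weaken⟧ v ρ (var i)  = Vec.lookup-++ʳ v ρ i
    ⟦weaken⟧ v ρ (con′ c) = refl
    ⟦weaken⟧ v ρ min′     = refl
    ⟦weaken⟧ v ρ one′     = refl
    ⟦weaken⟧ v ρ max′     = refl

  ∃ⁿ : ∀ k {m} → Formula σ (k + m) → Formula σ m
  ∃ⁿ zero    φ = φ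
  ∃ⁿ (suc k) φ = ∃ⁿ k (∃′ φ)

  Sat-∃ⁿ : ∀ 𝔄 k {m} (φ : Formula σ (k + m)) ρ →
    Sat 𝔄 (∃ⁿ k φ) ρ ⇔ (∃[ v ] Sat 𝔄 φ (v Vec.++ ρ))
  Sat-∃ⁿ 𝔄 zero    φ ρ = mk⇔ (λ h → [] , h) (λ { ([] , h) → h })
  Sat-∃ⁿ 𝔄 (suc k) φ ρ = mk⇔
    (λ h → (λ (v , a , h′) → a ∷ v , h′) (to ih h))
    (λ { (a ∷ v , h) → from ih (v , a , h) })
    where
    ih : Sat 𝔄 (∃ⁿ k (∃′ φ)) ρ ⇔ (∃[ v ] ∃[ a ] Sat 𝔄 φ (a ∷ v Vec.++ ρ))
    ih = Sat-∃ⁿ 𝔄 k (∃′ φ) ρ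

  -- Satisfaction in a finite structure is decidable. This supplies the classical steps by which
  -- `_⇒ᵈ_` and `∀ᵈ` are obtained from negation, disjunction and `∃ᵈ`.
  decide : ∀ {s Q} → Definable s Q → ∀ 𝔄 x → Dec (Q 𝔄 x)
  decide {s} {Q} D 𝔄 x = map′ (subst (Q 𝔄) eq ∘ to spec) (from spec ∘ subst (Q 𝔄) (sym eq))
    (sat? 𝔄 (formula D ts) (toVec s x Vec.++ []))
    where
    ts   = fromVec s (variables (width s) {0})
    spec = correct D 𝔄 (toVec s x Vec.++ []) ts
    eq   : eval 𝔄 (toVec s x Vec.++ []) s ts ≡ x
    eq   = trans (mapₛ-fromVec s _ _)
      (trans (cong (fromVec s) (map-variables 𝔄 (toVec s x) [])) (fromVec-toVec s x))

  equivalent : ∀ {s Q R} → (∀ 𝔄 x → Q 𝔄 x ⇔ R 𝔄 x) → Definable s Q → Definable s R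
  equivalent eq D = record
    { formula = formula D
    ; correct = λ 𝔄 ρ ts → mk⇔ (to (eq 𝔄 _) ∘ to (correct D 𝔄 ρ ts))
                               (from (correct D 𝔄 ρ ts) ∘ from (eq 𝔄 _))
    }

  -- A polymorphic `f` acts on terms and on elements alike, and naturality says that it commutes
  -- with evaluation. When `f` merely projects and rearranges components, naturality holds by
  -- `refl`.
  substitute : ∀ {s t Q} (f : ∀ {A} → Tuple s A → Tuple t A) →
    (∀ {A B} (g : A → B) x → mapₛ t g (f x) ≡ f (mapₛ s g x)) →
    Definable t Q → Definable s (λ 𝔄 x → Q 𝔄 (f x))
  substitute {Q = Q} f natural D = record
    { formula = λ ts → formula D (f ts)
    ; correct = λ 𝔄 ρ ts → mk⇔
        (subst (Q 𝔄) (natural _ ts) ∘ to (correct D 𝔄 ρ (f ts)))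
        (from (correct D 𝔄 ρ (f ts)) ∘ subst (Q 𝔄) (sym (natural _ ts)))
    }

  true-def : ∀ {s} → Definable s (λ _ _ → ⊤)
  true-def = record { formula = λ _ → min′ ≈′ min′ ; correct = λ _ _ _ → mk⇔ _ (λ _ → refl) }

  infixr 3 _∧ᵈ_
  infixr 2 _∨ᵈ_
  infixr 1 _⇒ᵈ_

  ¬ᵈ_ : ∀ {s Q} → Definable s Q → Definable s (λ 𝔄 x → ¬ Q 𝔄 x)
  ¬ᵈ D = record
    { formula = λ ts → ¬′ formula D ts
    ; correct = λ 𝔄 ρ ts → mk⇔ (_∘ from (correct D 𝔄 ρ ts)) (_∘ to (correct D 𝔄 ρ ts))
    }

  _∧ᵈ_ : ∀ {s Q R} → Definable s Q → Definable s R → Definable s (λ 𝔄 x → Q 𝔄 x × R 𝔄 x)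
  D ∧ᵈ E = record
    { formula = λ ts → formula D ts ∧′ formula E ts
    ; correct = λ 𝔄 ρ ts → mk⇔
        (λ (h , k) → to (correct D 𝔄 ρ ts) h , to (correct E 𝔄 ρ ts) k)
        (λ (h , k) → from (correct D 𝔄 ρ ts) h , from (correct E 𝔄 ρ ts) k)
    }

  _∨ᵈ_ : ∀ {s Q R} → Definable s Q → Definable s R → Definable s (λ 𝔄 x → Q 𝔄 x ⊎ R 𝔄 x)
  D ∨ᵈ E = record
    { formula = λ ts → formula D ts ∨′ formula E ts
    ; correct = λ 𝔄 ρ ts → mk⇔
        (Sum.map (to (correct D 𝔄 ρ ts)) (to (correct E 𝔄 ρ ts)))
        (Sum.map (from (correct D 𝔄 ρ ts)) (from (correct E 𝔄 ρ ts)))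
    }

  _⇒ᵈ_ : ∀ {s Q R} → Definable s Q → Definable s R → Definable s (λ 𝔄 x → Q 𝔄 x → R 𝔄 x)
  _⇒ᵈ_ {Q = Q} {R} D E = equivalent (λ 𝔄 x → mk⇔ classical (implication 𝔄 x)) (¬ᵈ D ∨ᵈ E)
    where
    classical : ∀ {P S : Set} → ¬ P ⊎ S → P → S
    classical (inj₁ ¬p) p = contradiction p ¬p
    classical (inj₂ s)  _ = s
    implication : ∀ 𝔄 x → (Q 𝔄 x → R 𝔄 x) → ¬ Q 𝔄 x ⊎ R 𝔄 x
    implication 𝔄 x f with decide D 𝔄 x
    ... | yes q = inj₂ (f q)
    ... | no ¬q = inj₁ ¬q

  ∃ᵈ : ∀ {s t Q} → Definable (t ⊗ s) Q → Definable s (λ 𝔄 x → ∃[ y ] Q 𝔄 (y , x))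
  ∃ᵈ {s} {t} {Q} D = record
    { formula = λ ts → ∃ⁿ k (body ts)
    ; correct = λ 𝔄 ρ ts → mk⇔
        (λ h → (λ (v , h′) → fromVec t v ,
            subst (Q 𝔄) (eval-body 𝔄 ρ ts v) (to (correct D 𝔄 (v Vec.++ ρ) (terms ts)) h′))
          (to (Sat-∃ⁿ 𝔄 k (body ts) ρ) h))
        (λ (y , q) → from (Sat-∃ⁿ 𝔄 k (body ts) ρ) (toVec t y ,
          from (correct D 𝔄 (toVec t y Vec.++ ρ) (terms ts))
            (subst (Q 𝔄) (sym (trans (eval-body 𝔄 ρ ts (toVec t y))
                                     (cong (_, _) (fromVec-toVec t y)))) q)))
    }
    where
    k = width t
    terms : ∀ {m} → Tuple s (Term σ m) → Tuple (t ⊗ s) (Term σ (k + m))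
    terms ts = fromVec t (variables k) , mapₛ s (weaken k) ts
    body : ∀ {m} → Tuple s (Term σ m) → Formula σ (k + m)
    body ts = formula D (terms ts)
    eval-body : ∀ 𝔄 {m} (ρ : Vec (Universe 𝔄) m) ts v →
      eval 𝔄 (v Vec.++ ρ) (t ⊗ s) (terms ts) ≡ (fromVec t v , eval 𝔄 ρ s ts)
    eval-body 𝔄 ρ ts v = cong₂ _,_
      (trans (mapₛ-fromVec t _ _) (cong (fromVec t) (map-variables 𝔄 v ρ)))
      (trans (mapₛ-∘ s _ _ ts) (mapₛ-cong s (⟦weaken⟧ 𝔄 v ρ) ts))

  ∀ᵈ : ∀ {s t Q} → Definable (t ⊗ s) Q → Definable s (λ 𝔄 x → ∀ y → Q 𝔄 (y , x))
  ∀ᵈ {Q = Q} D = equivalent (λ 𝔄 x → mk⇔ (λ ¬∃¬ y → stable 𝔄 x y (λ ¬q → ¬∃¬ (y , ¬q)))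
                                         (λ all (y , ¬q) → ¬q (all y)))
    (¬ᵈ (∃ᵈ (¬ᵈ D)))
    where
    stable : ∀ 𝔄 x y → ¬ ¬ Q 𝔄 (y , x) → Q 𝔄 (y , x)
    stable 𝔄 x y ¬¬q with decide D 𝔄 (y , x)
    ... | yes q = q
    ... | no ¬q = contradiction ¬q ¬¬q

  -- The index lives outside of the structure, so this is a finite disjunction and not a quantifier;
  -- it serves for states and symbols.
  ∃ᶠ : ∀ {s k} {Q : Fin k → ∀ 𝔄 → Val s 𝔄 → Set} → (∀ i → Definable s (Q i)) →
    Definable s (λ 𝔄 x → ∃[ i ] Q i 𝔄 x)
  ∃ᶠ {k = zero}  D = equivalent (λ _ _ → mk⇔ (λ ¬t → contradiction tt ¬t) (λ ())) (¬ᵈ true-def)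
  ∃ᶠ {k = suc k} D = equivalent
    (λ _ _ → mk⇔ [ (λ q → zero , q) , (λ (i , q) → suc i , q) ]′
                 (λ { (zero , q) → inj₁ q ; (suc i , q) → inj₂ (i , q) }))
    (D zero ∨ᵈ ∃ᶠ (D ∘ suc))

  ∀ᶠ : ∀ {s k} {Q : Fin k → ∀ 𝔄 → Val s 𝔄 → Set} → (∀ i → Definable s (Q i)) →
    Definable s (λ 𝔄 x → ∀ i → Q i 𝔄 x)
  ∀ᶠ {k = zero}  D = equivalent (λ _ _ → mk⇔ (λ _ ()) _) true-def
  ∀ᶠ {k = suc k} D = equivalent
    (λ _ _ → mk⇔ (λ { (q , qs) zero → q ; (q , qs) (suc i) → qs i })
                 (λ q → q zero , q ∘ suc))
    (D zero ∧ᵈ ∀ᶠ (D ∘ suc))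

  ⇔ᵈ : ∀ {s Q R} → Definable s Q → Definable s R →
    Definable s (λ 𝔄 x → (Q 𝔄 x → R 𝔄 x) × (R 𝔄 x → Q 𝔄 x))
  ⇔ᵈ D E = (D ⇒ᵈ E) ∧ᵈ (E ⇒ᵈ D)

  false-def : ∀ {s} → Definable s (λ _ _ → ⊥)
  false-def = equivalent (λ _ _ → mk⇔ (λ ¬t → ¬t tt) (λ ())) (¬ᵈ true-def)

  atom : ∀ {s Q} (φ : ∀ {m} → Tuple s (Term σ m) → Formula σ m) →
    (∀ 𝔄 {m} (ρ : Vec (Universe 𝔄) m) ts → Sat 𝔄 (φ ts) ρ ⇔ Q 𝔄 (eval 𝔄 ρ s ts)) →
    Definable s Q
  atom φ spec = record { formula = φ ; correct = spec }

  ≡-def : ∀ s → Definable (s ⊗ s) (λ _ (x , y) → x ≡ y)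
  ≡-def 𝟙       = equivalent (λ _ _ → mk⇔ (λ _ → refl) _) true-def
  ≡-def el      = atom (λ (t , u) → t ≈′ u) (λ _ _ _ → mk⇔ id id)
  ≡-def (s ⊗ t) = equivalent
    (λ _ _ → mk⇔ (λ { (refl , refl) → refl }) (λ { refl → refl , refl }))
    (substitute (λ ((x , _) , (x′ , _)) → x , x′) (λ _ _ → refl) (≡-def s) ∧ᵈ
     substitute (λ ((_ , y) , (_ , y′)) → y , y′) (λ _ _ → refl) (≡-def t))

  Lex-def : ∀ s → Definable (s ⊗ s) (λ _ (x , y) → Lex s x y)
  Lex-def 𝟙       = false-def
  Lex-def el      = equivalent (λ _ _ → mk⇔ (λ (le , ≢) → ≤∧≢⇒< le (≢ ∘ Fin.toℕ-injective))
                                            (λ lt → <⇒≤ lt , λ { refl → <-irrefl refl lt }))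
    (atom (λ (t , u) → t ≤′ u) (λ _ _ _ → mk⇔ id id) ∧ᵈ ¬ᵈ ≡-def el)
  Lex-def (s ⊗ t) =
    substitute (λ ((x , _) , (x′ , _)) → x , x′) (λ _ _ → refl) (Lex-def s) ∨ᵈ
    (substitute (λ ((x , _) , (x′ , _)) → x , x′) (λ _ _ → refl) (≡-def s) ∧ᵈ
     substitute (λ ((_ , y) , (_ , y′)) → y , y′) (λ _ _ → refl) (Lex-def t))

  BIT-def : Definable (el ⊗ el) (λ _ (x , i) → bit (toℕ x) (toℕ i) ≡ true)
  BIT-def = atom (λ (t , u) → BIT t u) (λ _ _ _ → T-≡)

  isMin : Definable el (λ 𝔄 x → x ≡ minᵤ 𝔄)
  isMin = atom (_≈′ min′) (λ _ _ _ → mk⇔ id id)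

  isOne : Definable el (λ 𝔄 x → x ≡ oneᵤ 𝔄)
  isOne = atom (_≈′ one′) (λ _ _ _ → mk⇔ id id)

  isCon : ∀ c → Definable el (λ 𝔄 x → x ≡ con 𝔄 c)
  isCon c = atom (_≈′ con′ c) (λ _ _ _ → mk⇔ id id)

-- Positions in sorted lists

-- A relation with natural numbers as indices, in order to compare positions directly with the heads
-- of a machine.
data _[_]=_ {A : Set} : List A → ℕ → A → Set where
  here  : ∀ {x xs} → (x ∷ xs) [ 0 ]= x
  there : ∀ {x y i xs} → xs [ i ]= x → (y ∷ xs) [ suc i ]= x

module _ {A : Set} where

  []=⇒∈ : ∀ {xs : List A} {i x} → xs [ i ]= x → x ∈ xs
  []=⇒∈ here      = here refl
  []=⇒∈ (there p) = there ([]=⇒∈ p)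

  ∈⇒[]= : ∀ {xs : List A} {x} → x ∈ xs → ∃[ i ] xs [ i ]= x
  ∈⇒[]= (here refl) = 0 , here
  ∈⇒[]= (there p)   = let i , q = ∈⇒[]= p in suc i , there q

  []=-exists : ∀ (xs : List A) {i} → i < length xs → ∃[ x ] xs [ i ]= x
  []=-exists (x ∷ xs) {zero}  _         = x , here
  []=-exists (x ∷ xs) {suc i} (s≤s i<n) = let y , q = []=-exists xs i<n in y , there q

  []=⇒< : ∀ {xs : List A} {i x} → xs [ i ]= x → i < length xs
  []=⇒< here      = z<s
  []=⇒< (there p) = s<s ([]=⇒< p)

  []=-functional : ∀ {xs : List A} {i x y} → xs [ i ]= x → xs [ i ]= y → x ≡ y
  []=-functional here      here      = refl
  []=-functional (there p) (there q) = []=-functional p q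

  []=-map : ∀ {B : Set} (f : A → B) {xs i x} → xs [ i ]= x → List.map f xs [ i ]= f x
  []=-map f here      = here
  []=-map f (there p) = there ([]=-map f p)

  []=-ordered : ∀ {R : A → A → Set} {xs i j x y} → AllPairs R xs →
    xs [ i ]= x → xs [ j ]= y → i < j → R x y
  []=-ordered (px ∷ _)  here      (there q) _         = All.lookup px ([]=⇒∈ q)
  []=-ordered (_ ∷ pxs) (there p) (there q) (s≤s i<j) = []=-ordered pxs p q i<j

module _ {A : Set} (_≺_ : A → A → Set) (xs : List A) where

  First Last : A → Set
  First x = x ∈ xs × (∀ z → z ∈ xs → ¬ (z ≺ x))
  Last  x = x ∈ xs × (∀ z → z ∈ xs → ¬ (x ≺ z))

  Successor : A → A → Set
  Successor x y = (x ∈ xs × y ∈ xs) × x ≺ y × (∀ z → z ∈ xs → x ≺ z → ¬ (z ≺ y))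

  -- The motion of a head on the list, in terms of the order alone so that it becomes first-order;
  -- at either end the head stays in place.
  Moves : Dir → A → A → Set
  Moves left  x y = Successor y x ⊎ (First x × x ≡ y)
  Moves stay  x y = x ≡ y
  Moves right x y = Successor x y ⊎ (Last x × x ≡ y)

  module _ (asym : ∀ {x y} → x ≺ y → ¬ (y ≺ x)) (sorted : AllPairs _≺_ xs) where

    ≺⇒< : ∀ {i j x y} → xs [ i ]= x → xs [ j ]= y → x ≺ y → i < j
    ≺⇒< {i} {j} p q x≺y with <-cmp i j
    ... | tri< i<j _ _  = i<j
    ... | tri≈ _ refl _ with refl ← []=-functional p q = contradiction x≺y (asym x≺y)
    ... | tri> _ _ j<i  = contradiction ([]=-ordered sorted q p j<i) (asym x≺y)

    []=-injective : ∀ {i j x} → xs [ i ]= x → xs [ j ]= x → i ≡ j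
    []=-injective {i} {j} p q with <-cmp i j
    ... | tri≈ _ i≡j _ = i≡j
    ... | tri< i<j _ _ = let x≺x = []=-ordered sorted p q i<j in contradiction x≺x (asym x≺x)
    ... | tri> _ _ j<i = let x≺x = []=-ordered sorted q p j<i in contradiction x≺x (asym x≺x)

    []=0⇔First : ∀ {x} → xs [ 0 ]= x ⇔ First x
    []=0⇔First = mk⇔
      (λ p → []=⇒∈ p , λ z z∈ z≺x → n≮0 (≺⇒< (proj₂ (∈⇒[]= z∈)) p z≺x))
      (λ (x∈ , first) → onlyFirst first (∈⇒[]= x∈))
      where
      onlyFirst : ∀ {x} → (∀ z → z ∈ xs → ¬ (z ≺ x)) → ∃[ i ] xs [ i ]= x → xs [ 0 ]= x
      onlyFirst first (zero  , p) = p
      onlyFirst first (suc i , p) =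
        let z , q = []=-exists xs (≤-<-trans z≤n ([]=⇒< p))
        in contradiction ([]=-ordered sorted q p z<s) (first z ([]=⇒∈ q))

    -- Were `y` further away than the next position, the entry at that position would lie strictly
    -- between `x` and `y`.
    successor⇒[]= : ∀ {i x y} → xs [ i ]= x → Successor x y → xs [ suc i ]= y
    successor⇒[]= {i} {x} {y} p ((_ , y∈) , x≺y , between) = adjacent (∈⇒[]= y∈)
      where
      adjacent : ∃[ j ] xs [ j ]= y → xs [ suc i ]= y
      adjacent (j , q) with m≤n⇒m<n∨m≡n (≺⇒< p q x≺y)
      ... | inj₂ refl = q
      ... | inj₁ 1+i<j =
        let z , r = []=-exists xs (<-trans 1+i<j ([]=⇒< q))
        in contradiction ([]=-ordered sorted r q 1+i<j)
             (between z ([]=⇒∈ r) ([]=-ordered sorted p r ≤-refl))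

    []=⇒successor : ∀ {i x y} → xs [ i ]= x → xs [ suc i ]= y → Successor x y
    []=⇒successor p q = ([]=⇒∈ p , []=⇒∈ q) , []=-ordered sorted p q ≤-refl , λ z z∈ x≺z z≺y →
      let _ , r = ∈⇒[]= z∈ in <⇒≱ (≺⇒< p r x≺z) (m<1+n⇒m≤n (≺⇒< r q z≺y))

    -- At the left end `pred` keeps the head at 0, at the right end the minimum holds it; these are
    -- the clauses of `Moves` with `First` and `Last`. In each case the other clause is
    -- contradictory.
    Moves⇔[]= : ∀ d {i x y} → xs [ i ]= x →
      Moves d x y ⇔ xs [ move d i ⊓ pred (length xs) ]= y
    Moves⇔[]= d {i} {x} {y} p = moves d p
      where
      i≤ : ∀ {i x} → xs [ i ]= x → i ≤ pred (length xs)
      i≤ q = <⇒≤pred ([]=⇒< q)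

      clip : ∀ {i x} → xs [ i ]= x → i ⊓ pred (length xs) ≡ i
      clip q = m≤n⇒m⊓n≡m (i≤ q)

      at : ∀ {i j} → j ≡ i → xs [ i ]= y → xs [ j ]= y
      at eq = subst (xs [_]= y) (sym eq)

      moves : ∀ d {i x} → xs [ i ]= x → Moves d x y ⇔ xs [ move d i ⊓ pred (length xs) ]= y
      moves stay p = mk⇔ (λ { refl → at (clip p) p })
        (λ q → []=-functional p (at (sym (clip p)) q))
      moves left {zero} {x} p = mk⇔ forth back
        where
        forth : Moves left x y → xs [ 0 ]= y
        forth (inj₁ s@((y∈ , _) , _)) =
          let _ , q = ∈⇒[]= y∈ in contradiction ([]=-injective p (successor⇒[]= q s)) 0≢1+n
        forth (inj₂ (_ , refl)) = p
        back : xs [ 0 ]= y → Moves left x y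
        back q = inj₂ (to []=0⇔First p , []=-functional p q)
      moves left {suc i} {x} p = mk⇔ forth back
        where
        i<n = []=⇒< p
        clipped : i ⊓ pred (length xs) ≡ i
        clipped = m≤n⇒m⊓n≡m (<⇒≤pred (<⇒≤ i<n))
        forth : Moves left x y → xs [ i ⊓ pred (length xs) ]= y
        forth (inj₁ s@((y∈ , _) , _)) = let _ , q = ∈⇒[]= y∈ in at clipped
          (subst (xs [_]= y) (suc-injective ([]=-injective (successor⇒[]= q s) p)) q)
        forth (inj₂ (first , _)) =
          contradiction ([]=-injective (from []=0⇔First first) p) 0≢1+n
        back : xs [ i ⊓ pred (length xs) ]= y → Moves left x y
        back q = inj₁ ([]=⇒successor (at (sym clipped) q) p)
      moves right {i} {x} p with suc i <? length xs
      ... | yes 1+i<n = mk⇔ forth back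
        where
        clipped : suc i ⊓ pred (length xs) ≡ suc i
        clipped = m≤n⇒m⊓n≡m (<⇒≤pred 1+i<n)
        forth : Moves right x y → xs [ suc i ⊓ pred (length xs) ]= y
        forth (inj₁ s) = at clipped (successor⇒[]= p s)
        forth (inj₂ ((_ , last) , _)) = let z , q = []=-exists xs 1+i<n in
          contradiction ([]=-ordered sorted p q ≤-refl) (last z ([]=⇒∈ q))
        back : xs [ suc i ⊓ pred (length xs) ]= y → Moves right x y
        back q = inj₁ ([]=⇒successor p (at (sym clipped) q))
      ... | no 1+i≮n = mk⇔ forth back
        where
        clipped : suc i ⊓ pred (length xs) ≡ i
        clipped = trans (m≥n⇒m⊓n≡n (≤-trans (pred[n]≤n {length xs}) (≮⇒≥ 1+i≮n)))
          (≤-antisym (pred-mono-≤ (≮⇒≥ 1+i≮n)) (i≤ p))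
        forth : Moves right x y → xs [ suc i ⊓ pred (length xs) ]= y
        forth (inj₁ s) = contradiction ([]=⇒< (successor⇒[]= p s)) 1+i≮n
        forth (inj₂ (_ , refl)) = at clipped p
        back : xs [ suc i ⊓ pred (length xs) ]= y → Moves right x y
        back q = inj₂ (([]=⇒∈ p , λ z z∈ x≺z →
                         let _ , r = ∈⇒[]= z∈ in 1+i≮n (≤-<-trans (≺⇒< p r x≺z) ([]=⇒< r)))
                      , []=-functional p (at (sym clipped) q))

-- Definable enumerations

pad : ∀ {A} s → A → Tuple s A
pad 𝟙       a = tt
pad el      a = a
pad (s ⊗ t) a = pad s a , pad t a

asVec : ∀ {A} k → Tuple (pow k el) A → Vec A k
asVec zero    x       = []
asVec (suc k) (a , x) = a ∷ asVec k x

ofVec : ∀ {A k} → Vec A k → Tuple (pow k el) A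
ofVec []      = tt
ofVec (a ∷ v) = a , ofVec v

asVec-ofVec : ∀ {A k} (v : Vec A k) → asVec k (ofVec v) ≡ v
asVec-ofVec []      = refl
asVec-ofVec (a ∷ v) = cong (a ∷_) (asVec-ofVec v)

ofVec-asVec : ∀ {A} k (x : Tuple (pow k el) A) → ofVec (asVec k x) ≡ x
ofVec-asVec zero    x       = refl
ofVec-asVec (suc k) (a , x) = cong (a ,_) (ofVec-asVec k x)

map-asVec : ∀ {A B} k (f : A → B) x → Vec.map f (asVec k x) ≡ asVec k (mapₛ (pow k el) f x)
map-asVec zero    f x       = refl
map-asVec (suc k) f (a , x) = cong (f a ∷_) (map-asVec k f x)

-- The order in which `bin` lists the tuples is thus the definable order of the sort. Its strictness
-- also yields that no tuple is listed twice.
tuples-sorted : ∀ n k → AllPairs (λ v w → Lex (pow k el) (ofVec v) (ofVec w)) (tuples n k)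
tuples-sorted n zero    = [] ∷ []
tuples-sorted n (suc k) = product-sorted (allFin n) (AllPairs.tabulate⁺-< id)
  where
  later : ∀ {x : Fin n} {v : Vec (Fin n) k} {ys} → All (x Fin.<_) ys →
    All (λ w → Lex (pow (suc k) el) (ofVec (x ∷ v)) (ofVec w))
        (cartesianProductWith _∷_ ys (tuples n k))
  later         []         = []
  later {x} {v} (x<y ∷ ps) = All.++⁺ (All.map⁺ (All.universal (λ _ → inj₁ x<y) (tuples n k)))
                                     (later {v = v} ps)
  product-sorted : ∀ xs → AllPairs Fin._<_ xs →
    AllPairs (λ v w → Lex (pow (suc k) el) (ofVec v) (ofVec w))
             (cartesianProductWith _∷_ xs (tuples n k))
  product-sorted []       []         = []
  product-sorted (x ∷ xs) (x< ∷ xs<) = AllPairs.++⁺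
    (AllPairs.map⁺ (AllPairs.map (λ v<w → inj₂ (refl , v<w)) (tuples-sorted n k)))
    (product-sorted xs xs<)
    (All.map⁺ (All.universal (λ v → later {v = v} x<) (tuples n k)))

∈-tuples : ∀ {n k} (v : Vec (Fin n) k) → v ∈ tuples n k
∈-tuples []      = here refl
∈-tuples (a ∷ v) = ∈-cartesianProductWith⁺ _∷_ (∈-allFin a) (∈-tuples v)

length-tuples : ∀ n k → length (tuples n k) ≡ n ^ k
length-tuples n zero    = refl
length-tuples n (suc k) = trans (product (allFin n))
  (cong₂ _*_ (List.length-tabulate {n = n} id) (length-tuples n k))
  where
  product : ∀ (xs : List (Fin n)) →
    length (cartesianProductWith (Vec._∷_ {n = k}) xs (tuples n k)) ≡
    length xs * length (tuples n k)
  product []       = refl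
  product (x ∷ xs) = trans (List.length-++ (List.map (Vec._∷_ x) (tuples n k)))
    (cong₂ _+_ (List.length-map (Vec._∷_ x) (tuples n k)) (product xs))

width-pow : ∀ k → width (pow k el) ≡ k
width-pow zero    = refl
width-pow (suc k) = cong suc (width-pow k)

‵-injective : ∀ {a b} → ‵ a ≡ ‵ b → a ≡ b
‵-injective refl = refl

_≟ˢ_ : DecidableEquality Symbol
⊢     ≟ˢ ⊢     = yes refl
⊢     ≟ˢ ⊣     = no (λ ())
⊢     ≟ˢ (‵ _) = no (λ ())
⊣     ≟ˢ ⊢     = no (λ ())
⊣     ≟ˢ ⊣     = yes refl
⊣     ≟ˢ (‵ _) = no (λ ())
(‵ _) ≟ˢ ⊢     = no (λ ())
(‵ _) ≟ˢ ⊣     = no (λ ())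
(‵ a) ≟ˢ (‵ b) = map′ (cong ‵_) (λ { refl → refl }) (a Bool.≟ b)

module _ {σ : Vocabulary} where

  size>0 : ∀ (𝔄 : Structure σ) → 0 < size 𝔄
  size>0 𝔄 = <-trans z<s (size≥2 𝔄)

  toℕ-minᵤ : ∀ (𝔄 : Structure σ) → toℕ (minᵤ 𝔄) ≡ 0
  toℕ-minᵤ 𝔄 = Fin.toℕ-fromℕ< _

  toℕ-oneᵤ : ∀ (𝔄 : Structure σ) → toℕ (oneᵤ 𝔄) ≡ 1
  toℕ-oneᵤ 𝔄 = Fin.toℕ-fromℕ< _

  toℕ-maxᵤ : ∀ (𝔄 : Structure σ) → toℕ (maxᵤ 𝔄) ≡ pred (size 𝔄)
  toℕ-maxᵤ 𝔄 = trans (Fin.opposite-prop (minᵤ 𝔄))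
    (cong (λ m → size 𝔄 ∸ suc m) (toℕ-minᵤ 𝔄))

  minᵤ<oneᵤ : ∀ (𝔄 : Structure σ) → minᵤ 𝔄 Fin.< oneᵤ 𝔄
  minᵤ<oneᵤ 𝔄 = subst₂ _<_ (sym (toℕ-minᵤ 𝔄)) (sym (toℕ-oneᵤ 𝔄)) z<s

  minᵤ≢oneᵤ : ∀ (𝔄 : Structure σ) → minᵤ 𝔄 ≢ oneᵤ 𝔄
  minᵤ≢oneᵤ 𝔄 eq = <-irrefl (cong toℕ eq) (minᵤ<oneᵤ 𝔄)

  isPad : ∀ s → Definable {σ} s (λ 𝔄 x → x ≡ pad s (minᵤ 𝔄))
  isPad 𝟙       = equivalent (λ _ _ → mk⇔ (λ _ → refl) _) true-def
  isPad el      = isMin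
  isPad (s ⊗ t) = equivalent
    (λ _ _ → mk⇔ (λ { (refl , refl) → refl }) (λ { refl → refl , refl }))
    (substitute proj₁ (λ _ _ → refl) (isPad s) ∧ᵈ substitute proj₂ (λ _ _ → refl) (isPad t))

  -- A list whose length varies with the structure. Strict order and definable membership make its
  -- first, last and successive entries first-order, and `bounded` makes its length polynomial in
  -- the size.
  record Enumeration : Set where
    field
      sort       : Sort
      list       : ∀ 𝔄 → List (Val {σ} sort 𝔄)
      sorted     : ∀ 𝔄 → AllPairs (Lex sort) (list 𝔄)
      member-def : Definable sort (λ 𝔄 x → x ∈ list 𝔄)
      bounded    : ∀ 𝔄 → length (list 𝔄) ≤ size 𝔄 ^ width sort

  open Enumeration public

  -- First-order access to a word that depends on the structure: the places are the entries of an
  -- enumeration, and each letter is a definable property of its place.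
  record Reader (ws : Structure σ → List Symbol) : Set where
    field
      enumeration : Enumeration
    open Enumeration enumeration public using () renaming (sort to position; list to positions)
    field
      label       : ∀ 𝔄 → Val position 𝔄 → Symbol
      label-def   : ∀ b → Definable position (λ 𝔄 x → label 𝔄 x ≡ b)
      labels      : ∀ 𝔄 → List.map (label 𝔄) (positions 𝔄) ≡ ws 𝔄

  open Reader public

  empty : Enumeration
  empty = record
    { sort       = 𝟙
    ; list       = λ _ → []
    ; sorted     = λ _ → []
    ; member-def = equivalent (λ _ _ → mk⇔ (λ ()) (λ ())) false-def
    ; bounded    = λ _ → z≤n
    }

  singleton : Enumeration
  singleton = record
    { sort       = 𝟙
    ; list       = λ _ → [ tt ]
    ; sorted     = λ _ → [] ∷ []
    ; member-def = equivalent (λ _ _ → mk⇔ (λ _ → here refl) _) true-def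
    ; bounded    = λ _ → ≤-refl
    }

  injˡ : ∀ s t (𝔄 : Structure σ) → Val s 𝔄 → Val (el ⊗ s ⊗ t) 𝔄
  injˡ s t 𝔄 x = minᵤ 𝔄 , x , pad t (minᵤ 𝔄)

  injʳ : ∀ s t (𝔄 : Structure σ) → Val t 𝔄 → Val (el ⊗ s ⊗ t) 𝔄
  injʳ s t 𝔄 y = oneᵤ 𝔄 , pad s (minᵤ 𝔄) , y

  -- The tag, zero or one, comes first and so puts the left part before the right part. The
  -- component that carries no information is padded, so that every entry has one code.
  append : Enumeration → Enumeration → Enumeration
  append E F = record
    { sort       = el ⊗ s ⊗ t
    ; list       = λ 𝔄 → List.map (injˡ s t 𝔄) (list E 𝔄) ++ List.map (injʳ s t 𝔄) (list F 𝔄)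
    ; sorted     = λ 𝔄 → AllPairs.++⁺
        (AllPairs.map⁺ (AllPairs.map (λ lt → inj₂ (refl , inj₁ lt)) (sorted E 𝔄)))
        (AllPairs.map⁺ (AllPairs.map (λ lt → inj₂ (refl , inj₂ (refl , lt))) (sorted F 𝔄)))
        (All.map⁺ (All.universal (λ _ → All.map⁺ (All.universal (λ _ → inj₁ (minᵤ<oneᵤ 𝔄)) _)) _))
    ; member-def = equivalent (λ 𝔄 x → mk⇔ (in-append 𝔄) (λ m → from-append 𝔄 m))
        ((substitute proj₁ (λ _ _ → refl) isMin ∧ᵈ
          substitute (λ (_ , x , _) → x) (λ _ _ → refl) (member-def E) ∧ᵈ
          substitute (λ (_ , _ , y) → y) (λ _ _ → refl) (isPad t)) ∨ᵈ
         (substitute proj₁ (λ _ _ → refl) isOne ∧ᵈ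
          substitute (λ (_ , x , _) → x) (λ _ _ → refl) (isPad s) ∧ᵈ
          substitute (λ (_ , _ , y) → y) (λ _ _ → refl) (member-def F)))
    ; bounded    = length≤
    }
    where
    s = sort E
    t = sort F
    InAppend : ∀ 𝔄 → Val (el ⊗ s ⊗ t) 𝔄 → Set
    InAppend 𝔄 (a , x , y) = (a ≡ minᵤ 𝔄 × x ∈ list E 𝔄 × y ≡ pad t (minᵤ 𝔄)) ⊎
                             (a ≡ oneᵤ 𝔄 × x ≡ pad s (minᵤ 𝔄) × y ∈ list F 𝔄)
    in-append : ∀ 𝔄 {z} → InAppend 𝔄 z →
      z ∈ List.map (injˡ s t 𝔄) (list E 𝔄) ++ List.map (injʳ s t 𝔄) (list F 𝔄)
    in-append 𝔄 (inj₁ (refl , x∈ , refl)) = ∈-++⁺ˡ (∈-map⁺ (injˡ s t 𝔄) x∈)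
    in-append 𝔄 (inj₂ (refl , refl , y∈)) = ∈-++⁺ʳ _ (∈-map⁺ (injʳ s t 𝔄) y∈)
    from-append : ∀ 𝔄 {z} →
      z ∈ List.map (injˡ s t 𝔄) (list E 𝔄) ++ List.map (injʳ s t 𝔄) (list F 𝔄) →
      InAppend 𝔄 z
    from-append 𝔄 z∈ with ∈-++⁻ (List.map (injˡ s t 𝔄) (list E 𝔄)) z∈
    ... | inj₁ p with _ , x∈ , refl ← ∈-map⁻ (injˡ s t 𝔄) p = inj₁ (refl , x∈ , refl)
    ... | inj₂ p with _ , y∈ , refl ← ∈-map⁻ (injʳ s t 𝔄) p = inj₂ (refl , refl , y∈)
    length≤ : ∀ 𝔄 → length (List.map (injˡ s t 𝔄) (list E 𝔄) ++ List.map (injʳ s t 𝔄) (list F 𝔄)) ≤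
      size 𝔄 ^ width (el ⊗ s ⊗ t)
    length≤ 𝔄 = begin
      length (xs ++ ys)                     ≡⟨ List.length-++ xs ⟩
      length xs + length ys                 ≡⟨ cong₂ _+_ (List.length-map _ (list E 𝔄))
                                                        (List.length-map _ (list F 𝔄)) ⟩
      length (list E 𝔄) + length (list F 𝔄) ≤⟨ +-mono-≤ (bounded E 𝔄) (bounded F 𝔄) ⟩
      n ^ width s + n ^ width t             ≤⟨ +-mono-≤ (^-monoʳ-≤ n (m≤m+n (width s) (width t)))
                                                        (^-monoʳ-≤ n (m≤n+m (width t) (width s))) ⟩
      n ^ w + n ^ w                         ≡⟨ cong (n ^ w +_) (+-identityʳ (n ^ w)) ⟨
      -- The element for the tag pays for adding up two lists, as there are at least two elements.
      2 * n ^ w                             ≤⟨ *-monoˡ-≤ (n ^ w) (size≥2 𝔄) ⟩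
      n * n ^ w                             ∎
      where
      open ≤-Reasoning
      n  = size 𝔄
      w  = width s + width t
      xs = List.map (injˡ s t 𝔄) (list E 𝔄)
      ys = List.map (injʳ s t 𝔄) (list F 𝔄)
      instance
        n≢0 : NonZero n
        n≢0 = >-nonZero (size>0 𝔄)

  -- The tag of a tuple in an appended enumeration tells the two parts apart.
  choose : ∀ {s t} {C : Set} (𝔄 : Structure σ) →
    (Val s 𝔄 → C) → (Val t 𝔄 → C) → Val (el ⊗ s ⊗ t) 𝔄 → C
  choose 𝔄 f g (a , x , y) = if does (a Fin.≟ minᵤ 𝔄) then f x else g y

  choose-injˡ : ∀ {s t C} 𝔄 (f : Val s 𝔄 → C) (g : Val t 𝔄 → C) x →
    choose {s} {t} 𝔄 f g (injˡ s t 𝔄 x) ≡ f x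
  choose-injˡ 𝔄 f g x rewrite dec-true (minᵤ 𝔄 Fin.≟ minᵤ 𝔄) refl = refl

  choose-injʳ : ∀ {s t C} 𝔄 (f : Val s 𝔄 → C) (g : Val t 𝔄 → C) y →
    choose {s} {t} 𝔄 f g (injʳ s t 𝔄 y) ≡ g y
  choose-injʳ 𝔄 f g y rewrite dec-false (oneᵤ 𝔄 Fin.≟ minᵤ 𝔄) (minᵤ≢oneᵤ 𝔄 ∘ sym) = refl

  choose⇔ : ∀ {s t C} 𝔄 (f : Val s 𝔄 → C) (g : Val t 𝔄 → C) a x y (c : C) →
    (a ≡ minᵤ 𝔄 × f x ≡ c ⊎ a ≢ minᵤ 𝔄 × g y ≡ c) ⇔ choose {s} {t} 𝔄 f g (a , x , y) ≡ c
  choose⇔ 𝔄 f g a x y c with a Fin.≟ minᵤ 𝔄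
  ... | yes eq = mk⇔ [ proj₂ , (λ (neq , _) → contradiction eq neq) ]′ (λ e → inj₁ (eq , e))
  ... | no neq = mk⇔ [ (λ (eq , _) → contradiction eq neq) , proj₂ ]′ (λ e → inj₂ (neq , e))

  constant-label : ∀ {s} b c → Definable {σ} s (λ _ _ → b ≡ c)
  constant-label b c with b ≟ˢ c
  ... | yes eq = equivalent (λ _ _ → mk⇔ (λ _ → eq) _) true-def
  ... | no neq = equivalent (λ _ _ → mk⇔ (λ ()) neq) false-def

  Bool-label : ∀ {s} {f : ∀ 𝔄 → Val s 𝔄 → Bool} →
    Definable {σ} s (λ 𝔄 x → f 𝔄 x ≡ true) → ∀ c → Definable s (λ 𝔄 x → ‵ f 𝔄 x ≡ c)
  Bool-label {f = f} D ⊢         = equivalent (λ _ _ → mk⇔ (λ ()) (λ ())) false-def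
  Bool-label D ⊣         = equivalent (λ _ _ → mk⇔ (λ ()) (λ ())) false-def
  Bool-label D (‵ true)  = equivalent (λ _ _ → mk⇔ (cong ‵_) ‵-injective) D
  Bool-label {f = f} D (‵ false) =
    equivalent (λ 𝔄 x → mk⇔ (λ ¬t → cong ‵_ (¬-not ¬t))
      (λ eq t → contradiction (trans (sym t) (‵-injective eq)) (λ ())))
      (¬ᵈ D)

  emptyReader : Reader (λ _ → [])
  emptyReader = record
    { enumeration = empty
    ; label       = λ _ _ → ⊣
    ; label-def   = constant-label ⊣
    ; labels      = λ _ → refl
    }

  singletonReader : ∀ b → Reader (λ _ → [ b ])
  singletonReader b = record
    { enumeration = singleton
    ; label       = λ _ _ → b
    ; label-def   = constant-label b
    ; labels      = λ _ → refl
    }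

  appendReader : ∀ {ws ws′} → Reader ws → Reader ws′ → Reader (λ 𝔄 → ws 𝔄 ++ ws′ 𝔄)
  appendReader {ws} {ws′} R S = record
    { enumeration = append (enumeration R) (enumeration S)
    ; label       = λ 𝔄 → choose {s} {t} 𝔄 (label R 𝔄) (label S 𝔄)
    ; label-def   = λ b → equivalent
        (λ 𝔄 (a , x , y) → choose⇔ {s} {t} 𝔄 (label R 𝔄) (label S 𝔄) a x y b)
        ((substitute proj₁ (λ _ _ → refl) isMin ∧ᵈ
          substitute (λ (_ , x , _) → x) (λ _ _ → refl) (label-def R b)) ∨ᵈ
         (¬ᵈ substitute proj₁ (λ _ _ → refl) isMin ∧ᵈ
          substitute (λ (_ , _ , y) → y) (λ _ _ → refl) (label-def S b)))
    ; labels      = λ 𝔄 → let f = choose {s} {t} 𝔄 (label R 𝔄) (label S 𝔄) in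
        trans (List.map-++ f (List.map (injˡ s t 𝔄) (positions R 𝔄)) _) (cong₂ _++_
          (trans (sym (List.map-∘ (positions R 𝔄)))
            (trans (List.map-cong (choose-injˡ {s} {t} 𝔄 (label R 𝔄) (label S 𝔄)) (positions R 𝔄))
              (labels R 𝔄)))
          (trans (sym (List.map-∘ (positions S 𝔄)))
            (trans (List.map-cong (choose-injʳ {s} {t} 𝔄 (label R 𝔄) (label S 𝔄)) (positions S 𝔄))
              (labels S 𝔄))))
    }
    where
    s = position R
    t = position S

  concatReader : ∀ {C : Set} {f : C → Structure σ → List Symbol} → (∀ c → Reader (f c)) →
    ∀ cs → Reader (λ 𝔄 → concatMap (λ c → f c 𝔄) cs)
  concatReader R []       = emptyReader
  concatReader R (c ∷ cs) = appendReader (R c) (concatReader R cs)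

  substReader : ∀ {ws ws′} → (∀ 𝔄 → ws 𝔄 ≡ ws′ 𝔄) → Reader ws → Reader ws′
  substReader eq R = record
    { enumeration = enumeration R
    ; label       = label R
    ; label-def   = label-def R
    ; labels      = λ 𝔄 → trans (labels R 𝔄) (eq 𝔄)
    }

  allTuples : ℕ → Enumeration
  allTuples k = record
    { sort       = pow k el
    ; list       = λ 𝔄 → List.map ofVec (tuples (size 𝔄) k)
    ; sorted     = λ 𝔄 → AllPairs.map⁺ (tuples-sorted (size 𝔄) k)
    ; member-def = equivalent (λ 𝔄 x → mk⇔
        (λ _ → subst (_∈ List.map ofVec (tuples (size 𝔄) k)) (ofVec-asVec k x)
          (∈-map⁺ ofVec (∈-tuples (asVec k x)))) _)
        true-def
    ; bounded    = λ 𝔄 → ≤-reflexive (trans (List.length-map ofVec (tuples (size 𝔄) k))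
        (trans (length-tuples (size 𝔄) k) (cong (size 𝔄 ^_) (sym (width-pow k)))))
    }

  relationReader : ∀ R → Reader (λ 𝔄 → List.map (λ v → ‵ rel 𝔄 R v) (tuples (size 𝔄) (arity σ R)))
  relationReader R = record
    { enumeration = allTuples k
    ; label       = λ 𝔄 x → ‵ rel 𝔄 R (asVec k x)
    ; label-def   = Bool-label {f = λ 𝔄 x → rel 𝔄 R (asVec k x)} (atom (λ ts → rel′ R (asVec k ts))
        (λ 𝔄 ρ ts → subst (λ v → T (rel 𝔄 R v) ⇔ rel 𝔄 R (asVec k (eval 𝔄 ρ (pow k el) ts)) ≡ true)
          (sym (map-asVec k _ ts)) T-≡))
    ; labels      = λ 𝔄 → trans (sym (List.map-∘ (tuples (size 𝔄) k)))
        (List.map-cong (λ v → cong (λ w → ‵ rel 𝔄 R w) (asVec-ofVec v)) (tuples (size 𝔄) k))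
    }
    where k = arity σ R

  -- `bin` writes constants with the most significant digit first, against the order of the
  -- universe; counting from the maximum restores an increasing order.
  fromEnd : ∀ (𝔄 : Structure σ) → ℕ → Universe 𝔄
  fromEnd 𝔄 p = fromℕ< {pred (size 𝔄) ∸ p}
    (≤-<-trans (m∸n≤m (pred (size 𝔄)) p) (pred[n]<n (size 𝔄) {{>-nonZero (size>0 𝔄)}}))
    where
    pred[n]<n : ∀ n .{{_ : NonZero n}} → pred n < n
    pred[n]<n (suc n) = ≤-refl

  toℕ-fromEnd : ∀ (𝔄 : Structure σ) p → toℕ (fromEnd 𝔄 p) ≡ pred (size 𝔄) ∸ p
  toℕ-fromEnd 𝔄 p = Fin.toℕ-fromℕ< _

  endDistance : ∀ (𝔄 : Structure σ) → Universe 𝔄 → ℕ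
  endDistance 𝔄 e = pred (size 𝔄) ∸ toℕ e

  endDistance-fromEnd : ∀ (𝔄 : Structure σ) {p} → p < size 𝔄 → endDistance 𝔄 (fromEnd 𝔄 p) ≡ p
  endDistance-fromEnd 𝔄 {p} p<n =
    trans (cong (pred (size 𝔄) ∸_) (toℕ-fromEnd 𝔄 p)) (m∸[m∸n]≡n (<⇒≤pred p<n))

  fromEnd-endDistance : ∀ (𝔄 : Structure σ) e → fromEnd 𝔄 (endDistance 𝔄 e) ≡ e
  fromEnd-endDistance 𝔄 e = Fin.toℕ-injective
    (trans (toℕ-fromEnd 𝔄 (endDistance 𝔄 e)) (m∸[m∸n]≡n (<⇒≤pred (Fin.toℕ<n e))))

  endDistance<size : ∀ (𝔄 : Structure σ) e → endDistance 𝔄 e < size 𝔄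
  endDistance<size 𝔄 e = ≤-<-trans (m∸n≤m (pred (size 𝔄)) (toℕ e)) (pred[n]<n (size>0 𝔄))
    where
    pred[n]<n : ∀ {n} → 0 < n → pred n < n
    pred[n]<n {suc n} _ = ≤-refl

  endDistance-def : Definable (el ⊗ el) (λ 𝔄 (p , e) → endDistance 𝔄 e ≡ toℕ p)
  endDistance-def = atom (λ (t , u) → PLUS t u max′) (λ 𝔄 ρ (t , u) → mk⇔
    (λ eq → trans (cong (_∸ ⟦ 𝔄 ⟧ℕ u ρ) (trans (sym (toℕ-maxᵤ 𝔄)) (sym eq)))
      (m+n∸n≡m (⟦ 𝔄 ⟧ℕ t ρ) (⟦ 𝔄 ⟧ℕ u ρ)))
    (λ eq → trans (cong (_+ ⟦ 𝔄 ⟧ℕ u ρ) (sym eq))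
      (trans (m∸n+n≡m (<⇒≤pred (Fin.toℕ<n (⟦ 𝔄 ⟧ u ρ)))) (sym (toℕ-maxᵤ 𝔄)))))

  -- There is no term for the end distance; being smaller than the size, it is the value of some
  -- element, which is quantified instead.
  viaEndDistance : ∀ {s} {Q : ∀ 𝔄 → ℕ → Val s 𝔄 → Set} →
    Definable (el ⊗ s) (λ 𝔄 (p , x) → Q 𝔄 (toℕ p) x) →
    Definable (el ⊗ s) (λ 𝔄 (e , x) → Q 𝔄 (endDistance 𝔄 e) x)
  viaEndDistance {s} {Q} D = equivalent (λ 𝔄 (e , x) → mk⇔
      (λ (p , eq , q) → subst (λ m → Q 𝔄 m x) (sym eq) q)
      (λ q → fromℕ< (endDistance<size 𝔄 e) , sym (Fin.toℕ-fromℕ< _) ,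
        subst (λ m → Q 𝔄 m x) (sym (Fin.toℕ-fromℕ< _)) q))
    (∃ᵈ {t = el} (substitute (λ (p , e , x) → p , e) (λ _ _ → refl) endDistance-def ∧ᵈ
                  substitute (λ (p , e , x) → p , x) (λ _ _ → refl) D))

  -- The numbers below L, in decreasing order: p is coded by max - p.
  downFrom : (L : Structure σ → ℕ) → (∀ 𝔄 → L 𝔄 ≤ size 𝔄) →
    Definable el (λ 𝔄 p → toℕ p < L 𝔄) → Enumeration
  downFrom L L≤n D = record
    { sort       = el
    ; list       = λ 𝔄 → applyDownFrom (fromEnd 𝔄) (L 𝔄)
    ; sorted     = λ 𝔄 → AllPairs.applyDownFrom⁺₁ (fromEnd 𝔄) (L 𝔄) λ {i} {j} j<i i<L →
        subst₂ _<_ (sym (toℕ-fromEnd 𝔄 i)) (sym (toℕ-fromEnd 𝔄 j))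
          (∸-monoʳ-< j<i (<⇒≤pred (<-≤-trans i<L (L≤n 𝔄))))
    ; member-def = equivalent (λ 𝔄 e → mk⇔
        (λ lt → subst (_∈ applyDownFrom (fromEnd 𝔄) (L 𝔄)) (fromEnd-endDistance 𝔄 e)
          (∈-applyDownFrom⁺ (fromEnd 𝔄) lt))
        (λ e∈ → below 𝔄 (∈-applyDownFrom⁻ (fromEnd 𝔄) e∈)))
        (substitute (λ e → e , tt) (λ _ _ → refl)
          (viaEndDistance {s = 𝟙} {Q = λ 𝔄 m _ → m < L 𝔄} (substitute proj₁ (λ _ _ → refl) D)))
    ; bounded    = λ 𝔄 → ≤-trans (≤-reflexive (List.length-applyDownFrom (fromEnd 𝔄) (L 𝔄)))
        (≤-trans (L≤n 𝔄) (≤-reflexive (sym (*-identityʳ (size 𝔄)))))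
    }
    where
    below : ∀ 𝔄 {e} → ∃[ p ] p < L 𝔄 × e ≡ fromEnd 𝔄 p → endDistance 𝔄 e < L 𝔄
    below 𝔄 (p , p<L , refl) =
      subst (_< L 𝔄) (sym (endDistance-fromEnd 𝔄 (<-≤-trans p<L (L≤n 𝔄)))) p<L

  applyDownFrom-cong : ∀ {A : Set} {f g : ℕ → A} n → (∀ {i} → i < n → f i ≡ g i) →
    applyDownFrom f n ≡ applyDownFrom g n
  applyDownFrom-cong zero    eq = refl
  applyDownFrom-cong (suc n) eq = cong₂ _∷_ (eq ≤-refl) (applyDownFrom-cong n (eq ∘ m<n⇒m<1+n))

  downReader : (L : Structure σ → ℕ) → (∀ 𝔄 → L 𝔄 ≤ size 𝔄) → Definable el (λ 𝔄 p → toℕ p < L 𝔄) →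
    (f : Structure σ → ℕ → Bool) → Definable el (λ 𝔄 p → f 𝔄 (toℕ p) ≡ true) →
    Reader (λ 𝔄 → applyDownFrom (λ p → ‵ f 𝔄 p) (L 𝔄))
  downReader L L≤n D f E = record
    { enumeration = downFrom L L≤n D
    ; label       = λ 𝔄 e → ‵ f 𝔄 (endDistance 𝔄 e)
    ; label-def   = Bool-label {f = λ 𝔄 e → f 𝔄 (endDistance 𝔄 e)}
        (substitute (λ e → e , tt) (λ _ _ → refl)
        (viaEndDistance {s = 𝟙} {Q = λ 𝔄 m _ → f 𝔄 m ≡ true} (substitute proj₁ (λ _ _ → refl) E)))
    ; labels      = λ 𝔄 → trans (List.map-applyDownFrom (fromEnd 𝔄) _ (L 𝔄))
        (applyDownFrom-cong (L 𝔄) (λ p<L → cong (λ m → ‵ f 𝔄 m)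
          (endDistance-fromEnd 𝔄 (<-≤-trans p<L (L≤n 𝔄)))))
    }

-- The input tape and the work tape

⌈log₂n⌉≤n : ∀ n → ⌈log₂ n ⌉ ≤ n
⌈log₂n⌉≤n n = subst (⌈log₂ n ⌉ ≤_) (⌈log₂2^n⌉≡n n) (⌈log₂⌉-mono-≤ (<⇒≤ (n<2^n n)))

true-ext : ∀ {a b} → (a ≡ true → b ≡ true) → (b ≡ true → a ≡ true) → a ≡ b
true-ext {true}  {b}     f g = sym (f refl)
true-ext {false} {true}  f g = g refl
true-ext {false} {false} f g = refl

≡ᵇ-true : ∀ m n → (m ≡ᵇ n) ≡ true ⇔ m ≡ n
≡ᵇ-true m n = mk⇔ (λ eq → ≡ᵇ⇒≡ m n (from T-≡ eq)) (λ eq → to T-≡ (≡⇒≡ᵇ m n eq))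

-- Elements of `Fin n` are below `2 ^ n`, so digit positions that are themselves in `Fin n` suffice.
bit-ext : ∀ {n} (x y : Fin n) → (∀ (i : Fin n) → bit (toℕ x) (toℕ i) ≡ bit (toℕ y) (toℕ i)) → x ≡ y
bit-ext {n} x y eq = Fin.toℕ-injective (bit-injective n (below x) (below y) λ i i<n →
  subst (λ j → bit (toℕ x) j ≡ bit (toℕ y) j) (Fin.toℕ-fromℕ< i<n) (eq (fromℕ< i<n)))
  where
  below : ∀ z → toℕ z < 2 ^ n
  below z = <-trans (Fin.toℕ<n z) (n<2^n n)

module _ {σ : Vocabulary} where

  -- A number is `2 ^ p` iff digit `p` is its only nonzero digit, which `BIT` can express.
  power-def : Definable {σ} (el ⊗ el) (λ 𝔄 (x , p) → toℕ x ≡ 2 ^ toℕ p)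
  power-def = equivalent (λ 𝔄 (x , p) → mk⇔ (isPower 𝔄 x p) (λ eq q →
      (λ b → Fin.toℕ-injective (to (≡ᵇ-true _ _) (trans (sym (bit-2^ (toℕ p) (toℕ q)))
        (trans (cong (λ m → bit m (toℕ q)) (sym eq)) b)))) ,
      (λ { refl → trans (cong (λ m → bit m (toℕ q)) eq)
        (trans (bit-2^ (toℕ p) (toℕ q)) (from (≡ᵇ-true (toℕ q) _) refl)) })))
    (∀ᵈ {t = el} (⇔ᵈ (substitute (λ (q , x , p) → x , q) (λ _ _ → refl) BIT-def)
                     (substitute (λ (q , x , p) → q , p) (λ _ _ → refl) (≡-def el))))
    where
    isPower : ∀ 𝔄 x p →
      (∀ q → (bit (toℕ x) (toℕ q) ≡ true → q ≡ p) × (q ≡ p → bit (toℕ x) (toℕ q) ≡ true)) →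
      toℕ x ≡ 2 ^ toℕ p
    isPower 𝔄 x p bits = bit-injective n (<-trans (Fin.toℕ<n x) (n<2^n n))
      (^-monoʳ-< 2 ≤-refl (Fin.toℕ<n p))
      λ i i<n → subst (λ j → bit (toℕ x) j ≡ bit (2 ^ toℕ p) j)
        (Fin.toℕ-fromℕ< i<n) (same (fromℕ< i<n))
      where
      n = size 𝔄
      same : ∀ (q : Fin n) → bit (toℕ x) (toℕ q) ≡ bit (2 ^ toℕ p) (toℕ q)
      same q = trans (true-ext
          (λ b → from (≡ᵇ-true (toℕ q) (toℕ p)) (cong toℕ (proj₁ (bits q) b)))
          (λ e → proj₂ (bits q) (Fin.toℕ-injective (to (≡ᵇ-true (toℕ q) (toℕ p)) e))))
        (sym (bit-2^ (toℕ p) (toℕ q)))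

  log-def : Definable {σ} el (λ 𝔄 p → toℕ p < ⌈log₂ size 𝔄 ⌉)
  log-def = equivalent (λ 𝔄 p → mk⇔
      (λ (x , eq) → from (p<⌈log₂n⌉⇔2^p<n (toℕ p) (size 𝔄)) (subst (_< size 𝔄) eq (Fin.toℕ<n x)))
      (λ p< → let 2^p<n = to (p<⌈log₂n⌉⇔2^p<n (toℕ p) (size 𝔄)) p< in
        fromℕ< 2^p<n , Fin.toℕ-fromℕ< 2^p<n))
    (∃ᵈ {t = el} power-def)

  -- The number of bits that can be set freely: ⌊log₂ size⌋.
  wordLength : Structure σ → ℕ
  wordLength 𝔄 = pred ⌈log₂ suc (size 𝔄) ⌉

  -- With `suc (size 𝔄)` under the ceiling, the strict bound of `p<⌈log₂n⌉⇔2^p<n` becomes a weak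
  -- one; this is how rounding down comes about.
  p<wordLength⇔2^[1+p]≤n : ∀ 𝔄 p → p < wordLength 𝔄 ⇔ 2 ^ suc p ≤ size 𝔄
  p<wordLength⇔2^[1+p]≤n 𝔄 p = mk⇔
    (λ lt → m<1+n⇒m≤n (to (p<⌈log₂n⌉⇔2^p<n (suc p) (suc (size 𝔄))) (suc[m]≤n⇒ lt)))
    (λ le → <⇒≤pred (from (p<⌈log₂n⌉⇔2^p<n (suc p) (suc (size 𝔄))) (s≤s le)))
    where
    suc[m]≤n⇒ : ∀ {m n} → m < pred n → suc m < n
    suc[m]≤n⇒ {n = suc n} lt = s≤s lt

  2^wordLength≤n : ∀ 𝔄 → 2 ^ wordLength 𝔄 ≤ size 𝔄
  2^wordLength≤n 𝔄 = lemma (wordLength 𝔄) (λ p → to (p<wordLength⇔2^[1+p]≤n 𝔄 p))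
    where
    lemma : ∀ ℓ → (∀ p → p < ℓ → 2 ^ suc p ≤ size 𝔄) → 2 ^ ℓ ≤ size 𝔄
    lemma zero    _ = size>0 𝔄
    lemma (suc p) f = f p ≤-refl

  wordLength≤n : ∀ 𝔄 → wordLength 𝔄 ≤ size 𝔄
  wordLength≤n 𝔄 = ≤-trans (<⇒≤ (n<2^n (wordLength 𝔄))) (2^wordLength≤n 𝔄)

  -- `2 ^ suc p` may equal the size and is then not an element. The formula asks instead for its
  -- predecessor, as the sum of `2 ^ p` and the predecessor of `2 ^ p`.
  wordLength-def : Definable {σ} el (λ 𝔄 p → toℕ p < wordLength 𝔄)
  wordLength-def = equivalent (λ 𝔄 p → mk⇔
      (λ (x , pow≡ , y , suc≡ , z , sum≡) → from (p<wordLength⇔2^[1+p]≤n 𝔄 (toℕ p)) (begin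
        2 * 2 ^ toℕ p         ≡⟨ cong (2 *_) pow≡ ⟨
        2 * toℕ x             ≡⟨ cong (toℕ x +_) (+-identityʳ (toℕ x)) ⟩
        toℕ x + toℕ x         ≡⟨ cong (toℕ x +_) suc≡ ⟨
        toℕ x + suc (toℕ y)   ≡⟨ +-suc (toℕ x) (toℕ y) ⟩
        suc (toℕ x + toℕ y)   ≡⟨ cong suc sum≡ ⟩
        suc (toℕ z)           ≤⟨ Fin.toℕ<n z ⟩
        size 𝔄                ∎))
      (λ lt → witness 𝔄 p (to (p<wordLength⇔2^[1+p]≤n 𝔄 (toℕ p)) lt)))
    (∃ᵈ {t = el} (power-def ∧ᵈ
      ∃ᵈ {t = el} (substitute (λ (y , x , p) → y , x) (λ _ _ → refl) SUC-def ∧ᵈ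
        ∃ᵈ {t = el} (substitute (λ (z , y , x , p) → x , y , z) (λ _ _ → refl) PLUS-def))))
    where
    open ≤-Reasoning
    SUC-def : Definable {σ} (el ⊗ el) (λ _ (x , y) → suc (toℕ x) ≡ toℕ y)
    SUC-def = atom (λ (t , u) → SUC t u) (λ _ _ _ → mk⇔ id id)
    PLUS-def : Definable {σ} (el ⊗ el ⊗ el) (λ _ (x , y , z) → toℕ x + toℕ y ≡ toℕ z)
    PLUS-def = atom (λ (t , u , v) → PLUS t u v) (λ _ _ _ → mk⇔ id id)
    witness : ∀ 𝔄 p → 2 ^ suc (toℕ p) ≤ size 𝔄 →
      ∃[ x ] toℕ x ≡ 2 ^ toℕ p × ∃[ y ] suc (toℕ {size 𝔄} y) ≡ toℕ x ×
        ∃[ z ] toℕ x + toℕ y ≡ toℕ {size 𝔄} z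
    witness 𝔄 p le = fromℕ< x< , toℕ-x , fromℕ< y< , suc≡ , fromℕ< z< , sum≡
      where
      n = size 𝔄
      x = 2 ^ toℕ p
      instance
        x≢0 : NonZero x
        x≢0 = m^n≢0 2 (toℕ p)
      x+x≤n : x + x ≤ n
      x+x≤n = subst (_≤ n) (cong (x +_) (+-identityʳ x)) le
      y<x : pred x < x
      y<x = ≤-reflexive (suc-pred x)
      z< : x + pred x < n
      z< = <-≤-trans (+-monoʳ-< x y<x) x+x≤n
      x< : x < n
      x< = <-≤-trans (m<m+n x (>-nonZero⁻¹ x)) x+x≤n
      y< : pred x < n
      y< = <-trans y<x x<
      toℕ-x : toℕ (fromℕ< x<) ≡ x
      toℕ-x = Fin.toℕ-fromℕ< x<
      suc≡ : suc (toℕ (fromℕ< y<)) ≡ toℕ (fromℕ< x<)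
      suc≡ = trans (cong suc (Fin.toℕ-fromℕ< y<)) (trans (suc-pred x) (sym toℕ-x))
      sum≡ : toℕ (fromℕ< x<) + toℕ (fromℕ< y<) ≡ toℕ (fromℕ< z<)
      sum≡ = trans (cong₂ _+_ toℕ-x (Fin.toℕ-fromℕ< y<)) (sym (Fin.toℕ-fromℕ< z<))

  -- This function and the next repeat the local ones of `bin`; `bin-split` identifies them after a
  -- case distinction on `#rel σ`, without which `bin` does not compute.
  constantBits : Structure σ → Fin (#con σ) → List Bool
  constantBits 𝔄 c = applyDownFrom (bit (toℕ (con 𝔄 c))) ⌈log₂ size 𝔄 ⌉

  relationBits : Structure σ → ℕ → List Bool
  relationBits 𝔄 zero    = replicate (size 𝔄) false
  relationBits 𝔄 (suc _) =
    concatMap (λ R → List.map (rel 𝔄 R) (tuples (size 𝔄) (arity σ R))) (allFin (#rel σ))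

  constantReader : ∀ c → Reader (λ 𝔄 → List.map ‵_ (constantBits 𝔄 c))
  constantReader c = substReader
    (λ 𝔄 → sym (List.map-applyDownFrom (bit (toℕ (con 𝔄 c))) ‵_ ⌈log₂ size 𝔄 ⌉))
    (downReader (λ 𝔄 → ⌈log₂ size 𝔄 ⌉) (λ 𝔄 → ⌈log₂n⌉≤n (size 𝔄)) log-def
      (λ 𝔄 → bit (toℕ (con 𝔄 c)))
      (equivalent (λ 𝔄 p → mk⇔ (λ { (x , refl , b) → b }) (λ b → con 𝔄 c , refl , b))
        (∃ᵈ {t = el} (substitute proj₁ (λ _ _ → refl) (isCon c) ∧ᵈ BIT-def))))

  relationsReader : ∀ k → Reader (λ 𝔄 → List.map ‵_ (relationBits 𝔄 k))
  relationsReader zero    = substReader (λ 𝔄 → falses (size 𝔄))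
    (downReader size (λ _ → ≤-refl) (equivalent (λ 𝔄 p → mk⇔ (λ _ → Fin.toℕ<n p) _) true-def)
      (λ _ _ → false) (equivalent (λ _ _ → mk⇔ (λ ()) (λ ())) false-def))
    where
    falses : ∀ n → applyDownFrom (λ _ → ‵ false) n ≡ List.map ‵_ (replicate n false)
    falses zero    = refl
    falses (suc n) = cong (‵ false ∷_) (falses n)
  relationsReader (suc k) = substReader
    (λ 𝔄 → trans (List.concatMap-cong (λ R → List.map-∘ (tuples (size 𝔄) (arity σ R)))
                   (allFin (#rel σ)))
      (sym (List.map-concatMap ‵_ (λ R → List.map (rel 𝔄 R) (tuples (size 𝔄) (arity σ R)))
        (allFin (#rel σ)))))
    (concatReader relationReader (allFin (#rel σ)))

framed : List Bool → List Symbol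
framed w = ⊢ ∷ List.map ‵_ w ++ [ ⊣ ]

bin-split : ∀ {σ} (𝔄 : Structure σ) →
  bin 𝔄 ≡ relationBits 𝔄 (#rel σ) ++ concatMap (constantBits 𝔄) (allFin (#con σ))
bin-split {record { #rel = zero }}  𝔄 = refl
bin-split {record { #rel = suc _ }} 𝔄 = refl

read-framed : ∀ w {i s} → framed w [ i ]= s → read w i ≡ s
read-framed w here      = refl
read-framed w (there p) = readFrom-framed w p
  where
  readFrom-framed : ∀ w {i s} → (List.map ‵_ w ++ [ ⊣ ]) [ i ]= s → readFrom w i ≡ s
  readFrom-framed []      here      = refl
  readFrom-framed (b ∷ w) here      = refl
  readFrom-framed (b ∷ w) (there p) = readFrom-framed w p

module _ {σ : Vocabulary} where

  tapeReader : Reader {σ} (framed ∘ bin)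
  tapeReader = appendReader (singletonReader ⊢) (appendReader binReader (singletonReader ⊣))
    where
    binReader : Reader (λ 𝔄 → List.map ‵_ (bin 𝔄))
    binReader = substReader
      (λ 𝔄 → trans (cong (List.map ‵_ (relationBits 𝔄 (#rel σ)) ++_)
                      (sym (List.map-concatMap ‵_ (constantBits 𝔄) (allFin (#con σ)))))
        (trans (sym (List.map-++ ‵_ (relationBits 𝔄 (#rel σ)) _))
          (cong (List.map ‵_) (sym (bin-split 𝔄)))))
      (appendReader (relationsReader (#rel σ)) (concatReader constantReader (allFin (#con σ))))

  module _ {w : Structure σ → List Bool} (R : Reader (framed ∘ w)) where

    length-positions : ∀ 𝔄 → length (positions R 𝔄) ≡ suc (suc (length (w 𝔄)))
    length-positions 𝔄 = trans (sym (List.length-map (label R 𝔄) (positions R 𝔄)))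
      (trans (cong length (labels R 𝔄))
        (cong suc (trans (List.length-++ (List.map ‵_ (w 𝔄)))
          (trans (cong (_+ 1) (List.length-map ‵_ (w 𝔄))) (+-comm _ 1)))))

    label-read : ∀ 𝔄 {i x} → positions R 𝔄 [ i ]= x → label R 𝔄 x ≡ read (w 𝔄) i
    label-read 𝔄 {i} {x} p = sym (read-framed (w 𝔄)
      (subst (_[ i ]= label R 𝔄 x) (labels R 𝔄) ([]=-map (label R 𝔄) p)))

  chunk : Enumeration {σ}
  chunk = downFrom wordLength wordLength≤n wordLength-def

  -- Storage for c * wordLength bits: bit p of the i-th element of the content
  -- is cell p of the i-th chunk.
  memory : ℕ → Enumeration {σ}
  memory zero    = empty
  memory (suc c) = append chunk (memory c)

  Cell : ℕ → Structure σ → Set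
  Cell c = Val (sort (memory c))

  Content : ℕ → Structure σ → Set
  Content c = Val (pow c el)

  cell : ∀ c 𝔄 → Cell c 𝔄 → Content c 𝔄 → Bool
  cell zero    𝔄 _ _        = false
  cell (suc c) 𝔄 x (z , zs) =
    choose {s = el} {t = sort (memory c)} 𝔄 (λ e → bit (toℕ z) (endDistance 𝔄 e))
      (λ y → cell c 𝔄 y zs) x

  cell-injˡ : ∀ c 𝔄 z zs {p} → p < wordLength 𝔄 →
    cell (suc c) 𝔄 (injˡ el (sort (memory c)) 𝔄 (fromEnd 𝔄 p)) (z , zs) ≡ bit (toℕ z) p
  cell-injˡ c 𝔄 z zs {p} p< = trans
    (choose-injˡ {s = el} {t = sort (memory c)} 𝔄 (λ e → bit (toℕ z) (endDistance 𝔄 e))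
       (λ y → cell c 𝔄 y zs) (fromEnd 𝔄 p))
    (cong (bit (toℕ z)) (endDistance-fromEnd 𝔄 (<-≤-trans p< (wordLength≤n 𝔄))))

  cell-injʳ : ∀ c 𝔄 z zs y →
    cell (suc c) 𝔄 (injʳ el (sort (memory c)) 𝔄 y) (z , zs) ≡ cell c 𝔄 y zs
  cell-injʳ c 𝔄 z zs y =
    choose-injʳ {s = el} {t = sort (memory c)} 𝔄 (λ e → bit (toℕ z) (endDistance 𝔄 e))
      (λ y → cell c 𝔄 y zs) y

  cell-def : ∀ c → Definable (sort (memory c) ⊗ pow c el) (λ 𝔄 (x , zs) → cell c 𝔄 x zs ≡ true)
  cell-def zero    = equivalent (λ _ _ → mk⇔ (λ ()) (λ ())) false-def
  cell-def (suc c) = equivalent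
    (λ 𝔄 ((a , e , y) , z , zs) → choose⇔ {s = el} {t = sort (memory c)} 𝔄
       (λ e → bit (toℕ z) (endDistance 𝔄 e)) (λ y → cell c 𝔄 y zs) a e y true)
    ((substitute (λ ((a , _) , _) → a) (λ _ _ → refl) isMin ∧ᵈ
      substitute (λ ((_ , e , _) , z , _) → e , z) (λ _ _ → refl)
        (viaEndDistance {s = el} {Q = λ 𝔄 m z → bit (toℕ z) m ≡ true}
          (substitute (λ (p , z) → z , p) (λ _ _ → refl) BIT-def))) ∨ᵈ
     (¬ᵈ substitute (λ ((a , _) , _) → a) (λ _ _ → refl) isMin ∧ᵈ
      substitute (λ ((_ , _ , y) , _ , zs) → y , zs) (λ _ _ → refl) (cell-def c)))

  -- No bit outside of the chunks is set, so that the cells determine the content.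
  Proper : ∀ c 𝔄 → Content c 𝔄 → Set
  Proper zero    𝔄 _        = ⊤
  Proper (suc c) 𝔄 (z , zs) =
    (∀ (p : Universe 𝔄) → bit (toℕ z) (toℕ p) ≡ true → toℕ p < wordLength 𝔄) × Proper c 𝔄 zs

  Proper-def : ∀ c → Definable (pow c el) (Proper c)
  Proper-def zero    = true-def
  Proper-def (suc c) =
    ∀ᵈ {t = el} (substitute (λ (p , z , _) → z , p) (λ _ _ → refl) BIT-def ⇒ᵈ
                 substitute proj₁ (λ _ _ → refl) wordLength-def) ∧ᵈ
    substitute proj₂ (λ _ _ → refl) (Proper-def c)

  cell-injective : ∀ c 𝔄 {zs zs′} → Proper c 𝔄 zs → Proper c 𝔄 zs′ →
    (∀ x → x ∈ list (memory c) 𝔄 → cell c 𝔄 x zs ≡ cell c 𝔄 x zs′) → zs ≡ zs′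
  cell-injective zero    𝔄 _ _ _ = refl
  cell-injective (suc c) 𝔄 {z , zs} {z′ , zs′} (proper , properₛ) (proper′ , properₛ′) eq =
    cong₂ _,_
    -- A digit set in one of the elements lies within the chunk by properness, hence is a cell, on
    -- which both contents agree.
    (bit-ext z z′ λ i → true-ext (λ b → trans (same i (proper i b)) b)
                                 (λ b → trans (sym (same i (proper′ i b))) b))
    (cell-injective c 𝔄 properₛ properₛ′ λ x x∈ → begin
      cell c 𝔄 x zs                     ≡⟨ cell-injʳ c 𝔄 z zs x ⟨
      cell (suc c) 𝔄 (injʳ el t 𝔄 x) (z , zs)   ≡⟨ eq _ (∈-++⁺ʳ _ (∈-map⁺ (injʳ el t 𝔄) x∈)) ⟩
      cell (suc c) 𝔄 (injʳ el t 𝔄 x) (z′ , zs′) ≡⟨ cell-injʳ c 𝔄 z′ zs′ x ⟩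
      cell c 𝔄 x zs′                    ∎)
    where
    open ≡-Reasoning
    t = sort (memory c)
    same : ∀ (i : Universe 𝔄) → toℕ i < wordLength 𝔄 → bit (toℕ z′) (toℕ i) ≡ bit (toℕ z) (toℕ i)
    same i i< = trans (sym (cell-injˡ c 𝔄 z′ zs′ i<)) (trans
      (sym (eq _ (∈-++⁺ˡ (∈-map⁺ (injˡ el t 𝔄) (∈-applyDownFrom⁺ (fromEnd 𝔄) i<)))))
      (cell-injˡ c 𝔄 z zs i<))

  -- Since the word length is rounded down, every pattern of digits in a chunk is below
  -- `2 ^ wordLength 𝔄` and so is the binary expansion of an element. With the logarithm rounded up,
  -- some patterns could belong to no element.
  store : ∀ c 𝔄 → (Cell c 𝔄 → Bool) → Content c 𝔄
  store zero    𝔄 g = tt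
  store (suc c) 𝔄 g =
    fromℕ< (<-≤-trans (fromBits<2^k (λ p → g (injˡ el t 𝔄 (fromEnd 𝔄 p))) (wordLength 𝔄))
              (2^wordLength≤n 𝔄)) ,
    store c 𝔄 (g ∘ injʳ el t 𝔄)
    where t = sort (memory c)

  Proper-store : ∀ c 𝔄 g → Proper c 𝔄 (store c 𝔄 g)
  Proper-store zero    𝔄 g = tt
  Proper-store (suc c) 𝔄 g = (λ p b → ≰⇒> λ ℓ≤p → contradiction
      (trans (sym b) (trans (cong (λ m → bit m (toℕ p)) (Fin.toℕ-fromℕ< _))
        (bit-beyond (λ p → g (injˡ el (sort (memory c)) 𝔄 (fromEnd 𝔄 p))) (wordLength 𝔄) ℓ≤p)))
      (λ ())) ,
    Proper-store c 𝔄 (g ∘ injʳ el (sort (memory c)) 𝔄)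

  cell-store : ∀ c 𝔄 g {x} → x ∈ list (memory c) 𝔄 → cell c 𝔄 x (store c 𝔄 g) ≡ g x
  cell-store (suc c) 𝔄 g x∈ with ∈-++⁻ (List.map (injˡ el (sort (memory c)) 𝔄) (list chunk 𝔄)) x∈
  ... | inj₂ x∈ʳ with y , y∈ , refl ← ∈-map⁻ (injʳ el (sort (memory c)) 𝔄) x∈ʳ =
    trans (cell-injʳ c 𝔄 _ (store c 𝔄 (g ∘ injʳ el (sort (memory c)) 𝔄)) y)
      (cell-store c 𝔄 (g ∘ injʳ el (sort (memory c)) 𝔄) y∈)
  ... | inj₁ x∈ˡ with e , e∈ , refl ← ∈-map⁻ (injˡ el (sort (memory c)) 𝔄) x∈ˡ
                 with p , p< , refl ← ∈-applyDownFrom⁻ (fromEnd 𝔄) e∈ =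
    trans (cell-injˡ c 𝔄 _ (store c 𝔄 (g ∘ injʳ el (sort (memory c)) 𝔄)) p<)
      (trans (cong (λ m → bit m p) (Fin.toℕ-fromℕ< _))
        (bit-fromBits (λ p → g (injˡ el (sort (memory c)) 𝔄 (fromEnd 𝔄 p))) (wordLength 𝔄) p<))

  length-memory : ∀ c 𝔄 → length (list (memory c) 𝔄) ≡ c * wordLength 𝔄
  length-memory zero    𝔄 = refl
  length-memory (suc c) 𝔄 = trans
    (List.length-++ (List.map (injˡ el (sort (memory c)) 𝔄) (list chunk 𝔄)))
    (cong₂ _+_ (trans (List.length-map _ (list chunk 𝔄))
                      (List.length-applyDownFrom (fromEnd 𝔄) (wordLength 𝔄)))
               (trans (List.length-map _ (list (memory c) 𝔄)) (length-memory c 𝔄)))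

-- Configurations and their successors

write-here : ∀ {A : Set} (f : ℕ → A) a {i j} → j ≡ i → write f i a j ≡ a
write-here f a {i} {j} eq with i ≡ᵇ j | from (≡ᵇ-true i j) (sym eq)
... | true | _ = refl

write-elsewhere : ∀ {A : Set} (f : ℕ → A) a {i j} → j ≢ i → write f i a j ≡ f j
write-elsewhere f a {i} {j} neq with i ≡ᵇ j | to (≡ᵇ-true i j)
... | false | _ = refl
... | true  | f = contradiction (sym (f refl)) neq

module _ {σ : Vocabulary} where

  ∃ˢ : ∀ {s} {Q : Symbol → ∀ 𝔄 → Val {σ} s 𝔄 → Set} → (∀ b → Definable s (Q b)) →
    Definable s (λ 𝔄 x → ∃[ b ] Q b 𝔄 x)
  ∃ˢ D = equivalent (λ _ _ → mk⇔
      [ (⊢ ,_) , [ (⊣ ,_) , [ (‵ false ,_) , (‵ true ,_) ]′ ]′ ]′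
      (λ { (⊢ , q) → inj₁ q ; (⊣ , q) → inj₂ (inj₁ q)
         ; (‵ false , q) → inj₂ (inj₂ (inj₁ q)) ; (‵ true , q) → inj₂ (inj₂ (inj₂ q)) }))
    (D ⊢ ∨ᵈ D ⊣ ∨ᵈ D (‵ false) ∨ᵈ D (‵ true))

  ≡true-def : ∀ {s} {f : ∀ 𝔄 → Val {σ} s 𝔄 → Bool} → Definable s (λ 𝔄 x → f 𝔄 x ≡ true) →
    ∀ b → Definable s (λ 𝔄 x → f 𝔄 x ≡ b)
  ≡true-def D true  = D
  ≡true-def D false = equivalent (λ _ _ → mk⇔ ¬-not not-¬) (¬ᵈ D)

  ≡Bool-def : ∀ {s} {f g : ∀ 𝔄 → Val {σ} s 𝔄 → Bool} → Definable s (λ 𝔄 x → f 𝔄 x ≡ true) →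
    Definable s (λ 𝔄 x → g 𝔄 x ≡ true) → Definable s (λ 𝔄 x → f 𝔄 x ≡ g 𝔄 x)
  ≡Bool-def D E = equivalent
    (λ _ _ → mk⇔ (λ (f , g) → true-ext f g) (λ eq → trans (sym eq) , trans eq)) (⇔ᵈ D E)

  -- A one-hot code of length `k` in the elements zero and one: a machine may have more states than
  -- a small structure has elements.
  unary : ∀ k → Fin k → ∀ 𝔄 → Val {σ} (pow k el) 𝔄
  unary (suc k) zero    𝔄 = oneᵤ 𝔄 , pad (pow k el) (minᵤ 𝔄)
  unary (suc k) (suc i) 𝔄 = minᵤ 𝔄 , unary k i 𝔄

  unary-injective : ∀ k {i j} 𝔄 → unary k i 𝔄 ≡ unary k j 𝔄 → i ≡ j
  unary-injective (suc k) {zero}  {zero}  𝔄 eq = refl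
  unary-injective (suc k) {zero}  {suc j} 𝔄 eq = contradiction (sym (cong proj₁ eq)) (minᵤ≢oneᵤ 𝔄)
  unary-injective (suc k) {suc i} {zero}  𝔄 eq = contradiction (cong proj₁ eq) (minᵤ≢oneᵤ 𝔄)
  unary-injective (suc k) {suc i} {suc j} 𝔄 eq = cong suc (unary-injective k 𝔄 (cong proj₂ eq))

  unary-def : ∀ k i → Definable {σ} (pow k el) (λ 𝔄 x → x ≡ unary k i 𝔄)
  unary-def (suc k) zero    = equivalent
    (λ _ _ → mk⇔ (λ { (refl , refl) → refl }) (λ { refl → refl , refl }))
    (substitute proj₁ (λ _ _ → refl) isOne ∧ᵈ substitute proj₂ (λ _ _ → refl) (isPad (pow k el)))
  unary-def (suc k) (suc i) = equivalent
    (λ _ _ → mk⇔ (λ { (refl , refl) → refl }) (λ { refl → refl , refl }))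
    (substitute proj₁ (λ _ _ → refl) isMin ∧ᵈ substitute proj₂ (λ _ _ → refl) (unary-def k i))

  module _ (E : Enumeration {σ}) where

    private
      s = sort E

    First-def : Definable s (λ 𝔄 x → First (Lex s) (list E 𝔄) x)
    First-def = member-def E ∧ᵈ
      ∀ᵈ {t = s} (substitute proj₁ (λ _ _ → refl) (member-def E) ⇒ᵈ ¬ᵈ Lex-def s)

    Last-def : Definable s (λ 𝔄 x → Last (Lex s) (list E 𝔄) x)
    Last-def = member-def E ∧ᵈ
      ∀ᵈ {t = s} (substitute proj₁ (λ _ _ → refl) (member-def E) ⇒ᵈ
                  ¬ᵈ substitute (λ (z , x) → x , z) (λ _ _ → refl) (Lex-def s))

    Successor-def : Definable (s ⊗ s) (λ 𝔄 (x , y) → Successor (Lex s) (list E 𝔄) x y)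
    Successor-def =
      (substitute proj₁ (λ _ _ → refl) (member-def E) ∧ᵈ
       substitute proj₂ (λ _ _ → refl) (member-def E)) ∧ᵈ
      Lex-def s ∧ᵈ
      ∀ᵈ {t = s} (substitute proj₁ (λ _ _ → refl) (member-def E) ⇒ᵈ
                  substitute (λ (z , x , y) → x , z) (λ _ _ → refl) (Lex-def s) ⇒ᵈ
                  ¬ᵈ substitute (λ (z , x , y) → z , y) (λ _ _ → refl) (Lex-def s))

    Moves-def : ∀ d → Definable (s ⊗ s) (λ 𝔄 (x , y) → Moves (Lex s) (list E 𝔄) d x y)
    Moves-def left  = substitute (λ (x , y) → y , x) (λ _ _ → refl) Successor-def ∨ᵈ
                      (substitute proj₁ (λ _ _ → refl) First-def ∧ᵈ ≡-def s)
    Moves-def stay  = ≡-def s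
    Moves-def right = Successor-def ∨ᵈ (substitute proj₁ (λ _ _ → refl) Last-def ∧ᵈ ≡-def s)

  module Simulation (word : Structure σ → List Bool) (tapeReader : Reader (framed ∘ word))
    (M : TM) (c : ℕ) where
    open TM M

    #codes : ℕ
    #codes = suc (suc #states)

    input work contents Node : Sort
    input    = position tapeReader
    work     = sort (memory {σ} c)
    contents = pow (suc #symbols) (pow c el)
    Node     = pow #codes el ⊗ input ⊗ work ⊗ contents

    inputs : ∀ (𝔄 : Structure σ) → List (Val {σ} input 𝔄)
    inputs = positions tapeReader

    cells : ∀ (𝔄 : Structure σ) → List (Val {σ} work 𝔄)
    cells = list (memory c)

    content : ∀ {A} → Γ → Tuple contents A → Tuple (pow c el) A
    content γ z = lookupₛ (pow c el) γ z

    -- Two states are added: that of the chord vertex and that of the start of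
    -- the path.
    chordCode startCode : Fin #codes
    chordCode = zero
    startCode = suc zero

    marker : Fin #codes → ∀ (𝔄 : Structure σ) → Val {σ} Node 𝔄
    marker i 𝔄 = unary #codes i 𝔄 , pad (input ⊗ work ⊗ contents) (minᵤ 𝔄)

    marker-def : ∀ i → Definable Node (λ (𝔄 : Structure σ) x → x ≡ marker i 𝔄)
    marker-def i = equivalent
      (λ _ _ → mk⇔ (λ { (refl , refl) → refl }) (λ { refl → refl , refl }))
      (substitute proj₁ (λ _ _ → refl) (unary-def #codes i) ∧ᵈ
       substitute proj₂ (λ _ _ → refl) (isPad (input ⊗ work ⊗ contents)))

    Tidy : ∀ (𝔄 : Structure σ) → Val contents 𝔄 → Set
    Tidy 𝔄 z = ∀ γ → Proper c 𝔄 (content γ z)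

    Tidy-def : Definable contents Tidy
    Tidy-def = ∀ᶠ (λ γ →
      substitute (content γ) (λ g z → mapₛ-lookupₛ (pow c el) γ g z) (Proper-def c))

    cellOf : Γ → ∀ (𝔄 : Structure σ) → Val work 𝔄 → Val contents 𝔄 → Bool
    cellOf γ 𝔄 p z = cell c 𝔄 p (content γ z)

    cellOf-def : ∀ γ →
      Definable (work ⊗ contents) (λ (𝔄 : Structure σ) (p , z) → cellOf γ 𝔄 p z ≡ true)
    cellOf-def γ = substitute (λ (p , z) → p , content γ z)
      (λ g (p , z) → cong (mapₛ work g p ,_) (mapₛ-lookupₛ (pow c el) γ g z)) (cell-def c)

    Initial : ∀ (𝔄 : Structure σ) → Val Node 𝔄 → Set
    Initial 𝔄 (s , h , v , z) =
      s ≡ unary #codes (suc (suc start)) 𝔄 × First (Lex input) (inputs 𝔄) h ×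
      First (Lex work) (cells 𝔄) v ×
      Tidy 𝔄 z × (∀ γ p → p ∈ cells 𝔄 → cellOf γ 𝔄 p z ≡ does (Fin._≟_ {suc #symbols} zero γ))

    Initial-def : Definable Node Initial
    Initial-def =
      substitute (λ (s , h , v , z) → s) (λ _ _ → refl) (unary-def #codes (suc (suc start))) ∧ᵈ
      substitute (λ (s , h , v , z) → h) (λ _ _ → refl) (First-def (enumeration tapeReader)) ∧ᵈ
      substitute (λ (s , h , v , z) → v) (λ _ _ → refl) (First-def (memory c)) ∧ᵈ
      substitute (λ (s , h , v , z) → z) (λ _ _ → refl) Tidy-def ∧ᵈ
      ∀ᶠ (λ γ → ∀ᵈ {t = work} (
        substitute (λ (p , s , h , v , z) → p) (λ _ _ → refl) (member-def (memory c)) ⇒ᵈ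
        ≡true-def {f = λ (𝔄 : Structure σ) (p , s , h , v , z) → cellOf γ 𝔄 p z}
          (substitute (λ (p , s , h , v , z) → p , z) (λ _ _ → refl) (cellOf-def γ)) _))

    Written : Γ → Γ → ∀ (𝔄 : Structure σ) →
      Val work 𝔄 → Val contents 𝔄 → Val contents 𝔄 → Val work 𝔄 → Set
    Written a γ 𝔄 v z z′ p = (p ≡ v × cellOf γ 𝔄 p z′ ≡ does (a Fin.≟ γ)) ⊎
                             (p ≢ v × cellOf γ 𝔄 p z′ ≡ cellOf γ 𝔄 p z)

    Update : State × Γ × Dir × Dir → ∀ (𝔄 : Structure σ) → Val (Node ⊗ Node) 𝔄 → Set
    Update (q , a , dᵢ , dⱼ) 𝔄 ((_ , h , v , z) , (s′ , h′ , v′ , z′)) =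
      s′ ≡ unary #codes (suc (suc q)) 𝔄 × Moves (Lex input) (inputs 𝔄) dᵢ h h′ ×
      Moves (Lex work) (cells 𝔄) dⱼ v v′ × Tidy 𝔄 z′ ×
      (∀ γ p → p ∈ cells 𝔄 → Written a γ 𝔄 v z z′ p)

    Update-def : ∀ r → Definable (Node ⊗ Node) (Update r)
    Update-def (q , a , dᵢ , dⱼ) =
      substitute (λ ((s , h , v , z) , (s′ , h′ , v′ , z′)) → s′) (λ _ _ → refl)
        (unary-def #codes (suc (suc q))) ∧ᵈ
      substitute (λ ((s , h , v , z) , (s′ , h′ , v′ , z′)) → h , h′) (λ _ _ → refl)
        (Moves-def (enumeration tapeReader) dᵢ) ∧ᵈ
      substitute (λ ((s , h , v , z) , (s′ , h′ , v′ , z′)) → v , v′) (λ _ _ → refl)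
        (Moves-def (memory c) dⱼ) ∧ᵈ
      substitute (λ ((s , h , v , z) , (s′ , h′ , v′ , z′)) → z′) (λ _ _ → refl) Tidy-def ∧ᵈ
      ∀ᶠ (λ γ → ∀ᵈ {t = work} (
        substitute proj₁ (λ _ _ → refl) (member-def (memory c)) ⇒ᵈ
        substitute (λ (p , (s , h , v , z) , (s′ , h′ , v′ , z′)) → p , v , z , z′)
          (λ _ _ → refl) (written γ)))
      where
      written : ∀ γ → Definable (work ⊗ work ⊗ contents ⊗ contents)
        (λ (𝔄 : Structure σ) (p , v , z , z′) → Written a γ 𝔄 v z z′ p)
      written γ =
        (atCell ∧ᵈ ≡true-def {f = λ (𝔄 : Structure σ) (p , v , z , z′) → cellOf γ 𝔄 p z′} new _) ∨ᵈ
        (¬ᵈ atCell ∧ᵈ ≡Bool-def {f = λ (𝔄 : Structure σ) (p , v , z , z′) → cellOf γ 𝔄 p z′}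
          {g = λ (𝔄 : Structure σ) (p , v , z , z′) → cellOf γ 𝔄 p z} new
          (substitute (λ (p , v , z , z′) → p , z) (λ _ _ → refl) (cellOf-def γ)))
        where
        atCell = substitute (λ (p , v , z , z′) → p , v) (λ _ _ → refl) (≡-def work)
        new    = substitute (λ (p , v , z , z′) → p , z′) (λ _ _ → refl) (cellOf-def γ)

    Reads : Symbol → Γ → ∀ (𝔄 : Structure σ) → Val Node 𝔄 → Set
    Reads b γ 𝔄 (_ , h , v , z) = label tapeReader 𝔄 h ≡ b × cellOf γ 𝔄 v z ≡ true

    Proceeds : Maybe Bool → State → ∀ (𝔄 : Structure σ) → Val (Node ⊗ Node) 𝔄 → Set
    Proceeds (just true)  q 𝔄 (x , y) = ⊥
    Proceeds (just false) q 𝔄 (x , y) = y ≡ marker startCode 𝔄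
    Proceeds nothing      q 𝔄 (x , y) = ∃[ b ] ∃[ γ ] Reads b γ 𝔄 x × Update (δ q b γ) 𝔄 (x , y)

    Follows : Fin #codes → ∀ (𝔄 : Structure σ) → Val (Node ⊗ Node) 𝔄 → Set
    Follows zero          𝔄 (x , y) = y ≡ marker startCode 𝔄
    Follows (suc zero)    𝔄 (x , y) = Initial 𝔄 y
    Follows (suc (suc q)) 𝔄 (x , y) = Proceeds (halt q) q 𝔄 (x , y)

    Follows-def : ∀ i → Definable (Node ⊗ Node) (Follows i)
    Follows-def zero          = substitute proj₂ (λ _ _ → refl) (marker-def startCode)
    Follows-def (suc zero)    = substitute proj₂ (λ _ _ → refl) Initial-def
    Follows-def (suc (suc q)) = proceeds (halt q)
      where
      proceeds : ∀ r → Definable (Node ⊗ Node) (Proceeds r q)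
      proceeds (just true)  = false-def
      proceeds (just false) = substitute proj₂ (λ _ _ → refl) (marker-def startCode)
      proceeds nothing      = ∃ˢ λ b → ∃ᶠ λ γ →
        (substitute (λ ((s , h , v , z) , y) → h) (λ _ _ → refl) (label-def tapeReader b) ∧ᵈ
         substitute (λ ((s , h , v , z) , y) → v , z) (λ _ _ → refl) (cellOf-def γ)) ∧ᵈ
        Update-def (δ q b γ)

    inputPart : ∀ {A} → Tuple Node A → Tuple input A
    inputPart (_ , h , _) = h

    workPart : ∀ {A} → Tuple Node A → Tuple work A
    workPart (_ , _ , v , _) = v

    contentPart : ∀ {A} → Tuple Node A → Tuple contents A
    contentPart (_ , _ , _ , z) = z

    Step : ∀ (𝔄 : Structure σ) → Val (Node ⊗ Node) 𝔄 → Set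
    Step 𝔄 (x , y) = ∃[ i ] proj₁ x ≡ unary #codes i 𝔄 × Follows i 𝔄 (x , y)

    Step-def : Definable (Node ⊗ Node) Step
    Step-def = ∃ᶠ λ i →
      substitute (λ (x , y) → proj₁ x) (λ _ _ → refl) (unary-def #codes i) ∧ᵈ Follows-def i

    -- A node that codes no configuration may have several successors in Step;
    -- these are dropped to get a partial function.
    Next : ∀ (𝔄 : Structure σ) → Val (Node ⊗ Node) 𝔄 → Set
    Next 𝔄 (x , y) = Step 𝔄 (x , y) × (∀ y′ → Step 𝔄 (x , y′) → y′ ≡ y)

    Next-def : Definable (Node ⊗ Node) Next
    Next-def = Step-def ∧ᵈ
      ∀ᵈ {t = Node} (substitute (λ (y′ , x , y) → x , y′) (λ _ _ → refl) Step-def ⇒ᵈ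
                     substitute (λ (y′ , x , y) → y′ , y) (λ _ _ → refl) (≡-def Node))

    module _ (𝔄 : Structure σ) where

      w : List Bool
      w = word 𝔄

      -- The tape is compared only on the available cells. Within the space bound the head stays on
      -- them, and the function `wkTape` on all numbers need not be recovered from the code.
      record Encodes (k : Config M) (x : Val Node 𝔄) : Set where
        field
          state≡  : proj₁ x ≡ unary #codes (suc (suc (state k))) 𝔄
          input≡  : inputs 𝔄 [ inHead k ]= inputPart x
          work≡   : cells 𝔄 [ wkHead k ]= workPart x
          tidy    : Tidy 𝔄 (contentPart x)
          stored  : ∀ γ {j p} → cells 𝔄 [ j ]= p →
            cellOf γ 𝔄 p (contentPart x) ≡ does (wkTape k j Fin.≟ γ)

      open Encodes

      at-injective : ∀ {i j p} → cells 𝔄 [ i ]= p → cells 𝔄 [ j ]= p → i ≡ j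
      at-injective = []=-injective (Lex work) (cells 𝔄) (Lex-asym work) (sorted (memory c) 𝔄)

      encode : ∀ k → inHead k < suc (suc (length w)) → wkHead k < length (cells 𝔄) →
        ∃[ x ] Encodes k x
      encode k i< j< =
        let h , h≡ = []=-exists (inputs 𝔄)
              (subst (inHead k <_) (sym (length-positions tapeReader 𝔄)) i<)
            v , v≡ = []=-exists (cells 𝔄) j<
        in (unary #codes (suc (suc (state k))) 𝔄 , h , v , tabulateₛ (pow c el) written) , record
          { state≡ = refl
          ; input≡ = h≡
          ; work≡  = v≡
          ; tidy   = λ γ → subst (Proper c 𝔄) (sym (lookupₛ-tabulateₛ (pow c el) written γ))
                       (Proper-store c 𝔄 (bits γ))
          ; stored = λ γ {j} {p} p≡ → trans
              (cong (cell c 𝔄 p) (lookupₛ-tabulateₛ (pow c el) written γ))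
              (trans (cell-store c 𝔄 (bits γ) ([]=⇒∈ p≡))
                (cong (λ m → does (wkTape k m Fin.≟ γ)) (index-correct p≡)))
          }
        where
        -- The index of p in the list of cells, and 0 for the tuples outside of it.
        index : Val work 𝔄 → ℕ
        index p with decide (member-def (memory c)) 𝔄 p
        ... | yes p∈ = proj₁ (∈⇒[]= p∈)
        ... | no _   = 0
        index-correct : ∀ {j p} → cells 𝔄 [ j ]= p → index p ≡ j
        index-correct {p = p} p≡ with decide (member-def (memory c)) 𝔄 p
        ... | yes p∈ = at-injective (proj₂ (∈⇒[]= p∈)) p≡
        ... | no p∉  = contradiction ([]=⇒∈ p≡) p∉
        bits : Γ → Val work 𝔄 → Bool
        bits γ p = does (wkTape k (index p) Fin.≟ γ)
        written : Γ → Content c 𝔄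
        written γ = store c 𝔄 (bits γ)

      -- Tidiness leaves no freedom in the digits outside of the chunks, so the cells fix the
      -- contents. This is what makes the successors of a code unique.
      Encodes-unique : ∀ {k x y} → Encodes k x → Encodes k y → x ≡ y
      Encodes-unique {x = s , h , v , z} {s′ , h′ , v′ , z′} X Y = cong₂ _,_
        (trans (state≡ X) (sym (state≡ Y)))
        (cong₂ _,_ ([]=-functional (input≡ X) (input≡ Y))
        (cong₂ _,_ ([]=-functional (work≡ X) (work≡ Y))
          (lookupₛ-ext (suc #symbols) (pow c el) λ γ → cell-injective c 𝔄 (tidy X γ) (tidy Y γ)
            λ p p∈ → let _ , p≡ = ∈⇒[]= p∈ in trans (stored X γ p≡) (sym (stored Y γ p≡)))))

      input-first : ∀ {h} → inputs 𝔄 [ 0 ]= h ⇔ First (Lex input) (inputs 𝔄) h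
      input-first = []=0⇔First (Lex input) (inputs 𝔄) (Lex-asym input)
        (sorted (enumeration tapeReader) 𝔄)

      work-first : ∀ {v} → cells 𝔄 [ 0 ]= v ⇔ First (Lex work) (cells 𝔄) v
      work-first = []=0⇔First (Lex work) (cells 𝔄) (Lex-asym work) (sorted (memory c) 𝔄)

      Next-functional : ∀ {x y y′} → Next 𝔄 (x , y) → Next 𝔄 (x , y′) → y ≡ y′
      Next-functional (_ , unique) (step , _) = sym (unique _ step)

      Step⇔Follows : ∀ {i x y} → proj₁ x ≡ unary #codes i 𝔄 → Step 𝔄 (x , y) ⇔ Follows i 𝔄 (x , y)
      Step⇔Follows {i} {x} {y} eq = mk⇔
        (λ (j , eq′ , follows) → subst (λ j → Follows j 𝔄 (x , y))
          (unary-injective #codes 𝔄 (trans (sym eq′) eq)) follows)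
        (λ follows → i , eq , follows)

      -- `Next` asks that no other node be a step; this follows once the steps from `x` are
      -- characterised by a property that only one node has.
      deterministic : ∀ {x y} (P : Val Node 𝔄 → Set) → (∀ y → Step 𝔄 (x , y) ⇔ P y) →
        (∀ {y′} → P y′ → y′ ≡ y) → P y → Next 𝔄 (x , y)
      deterministic P step⇔ unique p = from (step⇔ _) p , λ y′ step → unique (to (step⇔ y′) step)

      Next-chord : Next 𝔄 (marker chordCode 𝔄 , marker startCode 𝔄)
      Next-chord = deterministic (_≡ marker startCode 𝔄)
        (λ _ → Step⇔Follows {chordCode} refl) id refl

      Next-start : ∀ {y} → Encodes (run M w 0) y → Next 𝔄 (marker startCode 𝔄 , y)
      Next-start Y = deterministic (Encodes (run M w 0)) (λ y → mk⇔
          (λ step → initial⇒encodes (to (Step⇔Follows {startCode} refl) step))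
          (λ Y → from (Step⇔Follows {startCode} refl) (encodes⇒initial Y)))
        (λ Y′ → Encodes-unique Y′ Y) Y
        where
        initial⇒encodes : ∀ {y} → Initial 𝔄 y → Encodes (run M w 0) y
        initial⇒encodes (s≡ , h-first , v-first , z-tidy , blank) = record
          { state≡ = s≡
          ; input≡ = from input-first h-first
          ; work≡  = from work-first v-first
          ; tidy   = z-tidy
          ; stored = λ γ p≡ → blank γ _ ([]=⇒∈ p≡)
          }
        encodes⇒initial : ∀ {y} → Encodes (run M w 0) y → Initial 𝔄 y
        encodes⇒initial Y = state≡ Y ,
          to input-first (input≡ Y) ,
          to work-first (work≡ Y) ,
          tidy Y , (λ γ p p∈ → stored Y γ (proj₂ (∈⇒[]= p∈)))

      Next-reject : ∀ {k x} → Encodes k x → halt (state k) ≡ just false →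
        Next 𝔄 (x , marker startCode 𝔄)
      Next-reject {k} {x} X eq = deterministic (_≡ marker startCode 𝔄)
        (λ y → subst (λ r → Step 𝔄 (x , y) ⇔ Proceeds r (state k) 𝔄 (x , y)) eq
          (Step⇔Follows (state≡ X)))
        id refl

      ¬Next-accept : ∀ {k x y} → Encodes k x → halt (state k) ≡ just true → ¬ Next 𝔄 (x , y)
      ¬Next-accept {k} {x} {y} X eq (step , _) =
        subst (λ r → Proceeds r (state k) 𝔄 (x , y)) eq (to (Step⇔Follows (state≡ X)) step)

      stepped : Config M → State × Γ × Dir × Dir → Config M
      stepped k (q , a , dᵢ , dⱼ) =
        config q (move dᵢ (inHead k) ⊓ suc (length w)) (move dⱼ (wkHead k))
          (write (wkTape k) (wkHead k) a)

      step-running : ∀ k → halt (state k) ≡ nothing →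
        step M w k ≡ stepped k (δ (state k) (read w (inHead k)) (wkTape k (wkHead k)))
      step-running k eq with halt (state k)
      ... | nothing = refl

      -- The steps from the code of `k` are shown to be exactly the codes of the stepped
      -- configuration, so `Encodes-unique` gives determinism.
      Next-running : ∀ {k x y} → Encodes k x → halt (state k) ≡ nothing → Encodes (step M w k) y →
        Next 𝔄 (x , y)
      Next-running {k} {x} {y} X running Y = deterministic (Encodes k′)
          (λ y → mk⇔
            (λ step → update⇒encodes (proceeds⇒update
              (subst (λ r → Proceeds r (state k) 𝔄 (x , y)) running
                (to (Step⇔Follows (state≡ X)) step))))
            (λ Y → from (Step⇔Follows (state≡ X))
              (subst (λ r → Proceeds r (state k) 𝔄 (x , y)) (sym running)
                (b , γ , (reads-input , reads-work) , encodes⇒update Y))))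
          (λ Y′ → Encodes-unique Y′ Y₀) Y₀
        where
        b  = read w (inHead k)
        γ  = wkTape k (wkHead k)
        r  = δ (state k) b γ
        k′ = stepped k r
        Y₀ : Encodes k′ y
        Y₀ = subst (λ k → Encodes k y) (step-running k running) Y

        reads-input : label tapeReader 𝔄 (inputPart x) ≡ b
        reads-input = label-read tapeReader 𝔄 (input≡ X)

        reads-work : cellOf γ 𝔄 (workPart x) (contentPart x) ≡ true
        reads-work = trans (stored X γ (work≡ X)) (dec-true (γ Fin.≟ γ) refl)

        -- The guessed symbols are the ones read: the label fixes `b′`, and at the work head only
        -- the digit for the current symbol is set, which fixes `γ′`.
        proceeds⇒update : ∀ {y} → Proceeds nothing (state k) 𝔄 (x , y) → Update r 𝔄 (x , y)
        proceeds⇒update {y} (b′ , γ′ , (h≡ , v≡) , update) =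
          subst₂ (λ b γ → Update (δ (state k) b γ) 𝔄 (x , y))
            (trans (sym h≡) reads-input) (sym γ≡γ′) update
          where
          γ≡γ′ : γ ≡ γ′
          γ≡γ′ with γ Fin.≟ γ′ | trans (sym (stored X γ′ (work≡ X))) v≡
          ... | yes eq | _ = eq

        -- The two end markers make `suc (length w)` the last position, so that clipping to the list
        -- agrees with the clipping in `step`.
        input⇔ : ∀ d {h′} → Moves (Lex input) (inputs 𝔄) d (inputPart x) h′ ⇔
          inputs 𝔄 [ move d (inHead k) ⊓ suc (length w) ]= h′
        input⇔ d {h′} = subst
          (λ m → Moves (Lex input) (inputs 𝔄) d (inputPart x) h′ ⇔
            inputs 𝔄 [ move d (inHead k) ⊓ m ]= h′)
          (cong pred (length-positions tapeReader 𝔄))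
          (Moves⇔[]= (Lex input) (inputs 𝔄) (Lex-asym input) (sorted (enumeration tapeReader) 𝔄)
            d (input≡ X))

        -- The machine does not clip the work head on the right. As `Y₀` places the moved head on a
        -- cell, the minimum in `Moves⇔[]=` has no effect here.
        work⇔ : ∀ {v′} → Moves (Lex work) (cells 𝔄) (proj₂ (proj₂ (proj₂ r))) (workPart x) v′ ⇔
          cells 𝔄 [ wkHead k′ ]= v′
        work⇔ {v′} = subst
          (λ m → Moves (Lex work) (cells 𝔄) (proj₂ (proj₂ (proj₂ r))) (workPart x) v′ ⇔ cells 𝔄 [ m ]= v′)
          (m≤n⇒m⊓n≡m (<⇒≤pred ([]=⇒< (work≡ Y₀))))
          (Moves⇔[]= (Lex work) (cells 𝔄) (Lex-asym work) (sorted (memory c) 𝔄) _ (work≡ X))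

        a = proj₁ (proj₂ r)

        update⇒encodes : ∀ {y} → Update r 𝔄 (x , y) → Encodes k′ y
        update⇒encodes {y} (s≡ , h-moves , v-moves , z-tidy , written) = record
          { state≡ = s≡
          ; input≡ = to (input⇔ _) h-moves
          ; work≡  = to work⇔ v-moves
          ; tidy   = z-tidy
          ; stored = λ γ p≡ → value γ p≡ (written γ _ ([]=⇒∈ p≡))
          }
          where
          value : ∀ γ {j p} → cells 𝔄 [ j ]= p →
            Written a γ 𝔄 (workPart x) (contentPart x) (contentPart y) p →
            cellOf γ 𝔄 p (contentPart y) ≡ does (wkTape k′ j Fin.≟ γ)
          value γ p≡ (inj₁ (refl , eq)) = trans eq
            (cong (λ (g : Γ) → does (g Fin.≟ γ))
              (sym (write-here (wkTape k) a (at-injective p≡ (work≡ X)))))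
          value γ p≡ (inj₂ (neq , eq)) = trans eq (trans (stored X γ p≡)
            (cong (λ (g : Γ) → does (g Fin.≟ γ)) (sym (write-elsewhere (wkTape k) a {wkHead k}
              λ { refl → neq ([]=-functional p≡ (work≡ X)) }))))

        encodes⇒update : ∀ {y} → Encodes k′ y → Update r 𝔄 (x , y)
        encodes⇒update {y} Y =
          state≡ Y , from (input⇔ _) (input≡ Y) , from work⇔ (work≡ Y) , tidy Y ,
          λ γ p p∈ → value γ (proj₂ (∈⇒[]= p∈))
          where
          value : ∀ γ {j p} → cells 𝔄 [ j ]= p →
            Written a γ 𝔄 (workPart x) (contentPart x) (contentPart y) p
          value γ {j} {p} p≡ with _≟ₛ_ {s = work} p (workPart x)
          ... | yes refl = inj₁ (refl , trans (stored Y γ p≡)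
            (cong (λ (g : Γ) → does (g Fin.≟ γ))
              (write-here (wkTape k) a (at-injective p≡ (work≡ X)))))
          ... | no neq = inj₂ (neq , trans (stored Y γ p≡) (trans
            (cong (λ (g : Γ) → does (g Fin.≟ γ)) (write-elsewhere (wkTape k) a {wkHead k}
              λ { refl → neq ([]=-functional p≡ (work≡ X)) }))
            (sym (stored X γ p≡))))

-- The reduction

T-does : ∀ {P : Set} (d : Dec P) → T (does d) ⇔ P
T-does (yes p) = mk⇔ (λ _ → p) _
T-does (no ¬p) = mk⇔ (λ ()) ¬p

Orientable-pullback : ∀ {V W : Set} {E : V → V → Set} {F : W → W → Set} (f : W → V) →
  (∀ {a b} → f a ≡ f b → a ≡ b) → (∀ {a b} → F a b → E (f a) (f b)) → Orientable E → Orientable F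
Orientable-pullback f injective F⇒E O = record
  { E₁          = λ a b → E₁ (f a) (f b)
  ; E₂          = λ a b → E₂ (f a) (f b)
  ; cover       = λ e → cover (F⇒E e)
  ; functional₁ = λ e e′ → injective (functional₁ e e′)
  ; functional₂ = λ e e′ → injective (functional₂ e e′)
  }
  where open Orientable O

-- Splitting the team amounts to charging the edges: `dep x y` says that a left vertex is charged at
-- most once, `dep y x` the same on the right. Distinctness and exhaustiveness of `x` and `y` make
-- an assignment out of any pair of values.
MC⇔Orientable : ∀ {X : Set} (x y : X) → x ≢ y → (∀ v → v ≡ x ⊎ v ≡ y) → ∀ 𝔅 →
  MC x y (dep x y ∨ dep y x) 𝔅 ⇔ Orientable (λ a b → pairs 𝔅 (a , b))
MC⇔Orientable {X} x y x≢y exhaust 𝔅 = mk⇔ orientation model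
  where
  U = Universe 𝔅

  orientation : MC x y (dep x y ∨ dep y x) 𝔅 → Orientable (λ a b → pairs 𝔅 (a , b))
  orientation (S , (_ , pairs⊆) , S₁ , S₂ , (S⊆ , _) , lift dep₁ , lift dep₂) = record
    { E₁          = λ a b → Rel x y S₁ (a , b)
    ; E₂          = λ a b → Rel x y S₂ (a , b)
    ; cover       = λ e → let s , s∈ , sx , sy = pairs⊆ e in
                    Sum.map (λ s∈ → s , s∈ , sx , sy) (λ s∈ → s , s∈ , sx , sy) (S⊆ s∈)
    ; functional₁ = λ (s , s∈ , sx , sy) (s′ , s′∈ , sx′ , sy′) →
                    trans (sym sy) (trans (dep₁ s s′ s∈ s′∈ (trans sx (sym sx′))) sy′)
    ; functional₂ = λ (s , s∈ , sx , sy) (s′ , s′∈ , sx′ , sy′) →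
                    trans (sym sx) (trans (dep₂ s s′ s∈ s′∈ (trans sy (sym sy′))) sx′)
    }

  assignment : U → U → X → U
  assignment a b v = [ (λ _ → a) , (λ _ → b) ]′ (exhaust v)

  assignment-x : ∀ a b → assignment a b x ≡ a
  assignment-x a b with exhaust x
  ... | inj₁ _   = refl
  ... | inj₂ x≡y = contradiction x≡y x≢y

  assignment-y : ∀ a b → assignment a b y ≡ b
  assignment-y a b with exhaust y
  ... | inj₁ y≡x = contradiction (sym y≡x) x≢y
  ... | inj₂ _   = refl

  model : Orientable (λ a b → pairs 𝔅 (a , b)) → MC x y (dep x y ∨ dep y x) 𝔅
  model O = S ,
    ((λ { (s , s∈ , refl , refl) → s∈ }) ,
     (λ {(a , b)} e → assignment a b ,
       subst₂ (λ a b → pairs 𝔅 (a , b)) (sym (assignment-x a b)) (sym (assignment-y a b)) e ,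
       assignment-x a b , assignment-y a b)) ,
    (λ s → S s × E₁ (s x) (s y)) , (λ s → S s × E₂ (s x) (s y)) ,
    ((λ s∈ → Sum.map (s∈ ,_) (s∈ ,_) (cover s∈)) , [ proj₁ , proj₁ ]′) ,
    lift (λ s s′ (_ , e) (_ , e′) eq → functional₁ (subst (λ a → E₁ a (s y)) eq e) e′) ,
    lift (λ s s′ (_ , e) (_ , e′) eq → functional₂ (subst (E₂ (s x)) eq e) e′)
    where
    open Orientable O
    -- Defined through the values at `x` and `y` alone, so that the charges carry over without
    -- comparing functions.
    S : (X → U) → Set
    S s = pairs 𝔅 (s x , s y)

module _ (M : TM) (w : List Bool) where
  open TM M

  halt-step : ∀ k {b} → halt (state k) ≡ just b → step M w k ≡ k
  halt-step k eq with halt (state k)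
  ... | just _ = refl

  halt-run : ∀ {t b} s → halt (state (run M w t)) ≡ just b → t ≤ s →
    halt (state (run M w s)) ≡ just b
  halt-run {t} s eq t≤s with m≤n⇒m<n∨m≡n t≤s
  halt-run s       eq _ | inj₂ refl      = eq
  halt-run (suc s) eq _ | inj₁ (s≤s t≤s) =
    let eq′ = halt-run s eq t≤s in trans (cong (halt ∘ state) (halt-step (run M w s) eq′)) eq′

  -- A halted configuration is repeated forever, so only the steps up to the first halting time are
  -- genuine. It is found by walking back from `t` as long as the configuration before has halted
  -- too.
  first-halt : ∀ t {b} → halt (state (run M w t)) ≡ just b →
    ∃[ u ] halt (state (run M w u)) ≡ just b ×
        (∀ {s} → s < u → halt (state (run M w s)) ≡ nothing)
  first-halt zero    eq = 0 , eq , λ ()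
  first-halt (suc t) {b} eq = search (halt (state (run M w t))) refl
    where
    search : ∀ r → halt (state (run M w t)) ≡ r →
      ∃[ u ] halt (state (run M w u)) ≡ just b ×
        (∀ {s} → s < u → halt (state (run M w s)) ≡ nothing)
    search (just _) eq′ = first-halt t
      (trans (cong (halt ∘ state) (sym (halt-step (run M w t) eq′))) eq)
    search nothing  eq′ = suc t , eq , running
      where
      running : ∀ {s} → s < suc t → halt (state (run M w s)) ≡ nothing
      running {s} (s≤s s≤t) with halt (state (run M w s)) in eq″
      ... | nothing = refl
      ... | just _  = contradiction (trans (sym eq′) (halt-run t eq″ s≤t)) (λ ())

  inHead≤ : ∀ t → inHead (run M w t) ≤ suc (length w)
  inHead≤ zero    = z≤n
  inHead≤ (suc t) with halt (state (run M w t))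
  ... | just _  = inHead≤ t
  ... | nothing = m⊓n≤n _ _

-- An input of length `m` polynomial in the size has logarithm at most `k * ⌈log₂ size 𝔄 ⌉`. The
-- factor 2 replaces the logarithm rounded up by the one rounded down, and the summand 1 is at most
-- `wordLength 𝔄` as the size is at least two.
log-capacity : ∀ {σ} (𝔄 : Structure σ) c k m → m ≤ size 𝔄 ^ k →
  c * suc ⌈log₂ m ⌉ ≤ (c * suc (k * 2)) * wordLength 𝔄
log-capacity 𝔄 c k m m≤ = begin
  c * suc ⌈log₂ m ⌉             ≤⟨ *-monoʳ-≤ c (s≤s (⌈log₂⌉-mono-≤ m≤)) ⟩
  c * suc ⌈log₂ size 𝔄 ^ k ⌉    ≤⟨ *-monoʳ-≤ c (s≤s (⌈log₂n^k⌉≤k*⌈log₂n⌉ (size 𝔄) k)) ⟩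
  c * suc (k * ⌈log₂ size 𝔄 ⌉)  ≤⟨ *-monoʳ-≤ c (s≤s (*-monoʳ-≤ k log≤2*ℓ)) ⟩
  c * suc (k * (2 * ℓ))         ≤⟨ *-monoʳ-≤ c (+-monoˡ-≤ (k * (2 * ℓ)) 1≤ℓ) ⟩
  c * (ℓ + k * (2 * ℓ))         ≡⟨ cong (λ j → c * (ℓ + j)) (*-assoc k 2 ℓ) ⟨
  c * (suc (k * 2) * ℓ)         ≡⟨ *-assoc c (suc (k * 2)) ℓ ⟨
  c * suc (k * 2) * ℓ           ∎
  where
  open ≤-Reasoning
  ℓ = wordLength 𝔄
  1≤ℓ : 1 ≤ ℓ
  1≤ℓ = from (p<wordLength⇔2^[1+p]≤n 𝔄 0) (size≥2 𝔄)
  log≤2*ℓ : ⌈log₂ size 𝔄 ⌉ ≤ 2 * ℓ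
  log≤2*ℓ = begin
    ⌈log₂ size 𝔄 ⌉       ≤⟨ ⌈log₂⌉-mono-≤ (n≤1+n (size 𝔄)) ⟩
    ⌈log₂ suc (size 𝔄) ⌉ ≤⟨ m≤n+m∸n _ 1 ⟩
    1 + ℓ                ≤⟨ +-monoˡ-≤ ℓ 1≤ℓ ⟩
    ℓ + ℓ                ≡⟨ cong (ℓ +_) (+-identityʳ ℓ) ⟨
    2 * ℓ                ∎

two-elements : ∀ {A : Set} {a b : A} {xs} → a ∈ xs → b ∈ xs → a ≢ b → 2 ≤ length xs
two-elements (here refl) (here refl) a≢b = contradiction refl a≢b
two-elements {xs = _ ∷ _ ∷ _} _ _ _ = s≤s (s≤s z≤n)
two-elements {xs = _ ∷ []} (there ()) _ _
two-elements {xs = _ ∷ []} _ (there ()) _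

lookup-injective : ∀ {A : Set} {xs : List A} → AllPairs _≢_ xs →
  ∀ i j → List.lookup xs i ≡ List.lookup xs j → i ≡ j
lookup-injective (_ ∷ _)   zero    zero    _  = refl
lookup-injective (p ∷ _)   zero    (suc j) eq = contradiction eq (All.lookup p (∈-lookup j))
lookup-injective (p ∷ _)   (suc i) zero    eq = contradiction (sym eq) (All.lookup p (∈-lookup i))
lookup-injective (_ ∷ ps)  (suc i) (suc j) eq = cong suc (lookup-injective ps i j eq)

-- A definable binary relation on the tuples of sort s, as a query whose image
-- has these tuples as its elements.
module GraphQuery {σ : Vocabulary} (s : Sort)
  {Q : (𝔄 : Structure σ) → Val (s ⊗ s) 𝔄 → Set} (D : Definable (s ⊗ s) Q)
  (a b : (𝔄 : Structure σ) → Val s 𝔄) (a≢b : (𝔄 : Structure σ) → a 𝔄 ≢ b 𝔄) where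

  dim : ℕ
  dim = width s

  everything : Formula σ dim
  everything = min′ ≈′ min′

  ∈-extension : ∀ 𝔄 v → v ∈ extension 𝔄 everything
  ∈-extension 𝔄 v = ∈-filter⁺ (sat? 𝔄 everything) (∈-tuples v) refl

  -- `2 * dim` unfolds to `dim + (dim + 0)`: the first block is the initial segment, and the second
  -- one is weakened past it.
  variablePair : Tuple (s ⊗ s) (Term σ (2 * dim))
  variablePair = fromVec s (variables dim) , fromVec s (Vec.map (weaken dim) (variables dim))

  eval-variablePair : ∀ 𝔄 (u v : Vec (Universe 𝔄) dim) →
    eval 𝔄 (u Vec.++ (v Vec.++ [])) (s ⊗ s) variablePair ≡ (fromVec s u , fromVec s v)
  eval-variablePair 𝔄 u v = cong₂ _,_
    (trans (mapₛ-fromVec s _ (variables dim)) (cong (fromVec s) (map-variables 𝔄 u (v Vec.++ []))))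
    (trans (mapₛ-fromVec s _ (Vec.map (weaken dim) (variables dim))) (cong (fromVec s)
      (trans (sym (Vec.map-∘ _ (weaken dim) (variables dim)))
        (trans (Vec.map-cong (⟦weaken⟧ 𝔄 u (v Vec.++ [])) (variables dim))
               (map-variables 𝔄 v [])))))

  query : Query σ teamVocabulary
  query = record
    { dim       = dim
    ; φ₀        = everything
    ; φ         = λ _ → formula D variablePair
    ; ψ         = λ ()
    ; φ₀-size≥2 = λ 𝔄 → two-elements (∈-extension 𝔄 (toVec s (a 𝔄))) (∈-extension 𝔄 (toVec s (b 𝔄)))
                          (a≢b 𝔄 ∘ toVec-injective)
    ; ψ-unique  = λ 𝔄 ()
    }
    where
    toVec-injective : ∀ {A : Set} {x y : Tuple s A} → toVec s x ≡ toVec s y → x ≡ y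
    toVec-injective {x = x} {y} eq =
      trans (sym (fromVec-toVec s x)) (trans (cong (fromVec s) eq) (fromVec-toVec s y))

  module _ (𝔄 : Structure σ) where

    Vertex : Set
    Vertex = Universe (apply query 𝔄)

    value : Vertex → Val s 𝔄
    value i = fromVec s (List.lookup (extension 𝔄 everything) i)

    -- The tuples are listed in strictly increasing order, hence without repetition, and `filter`
    -- preserves this.
    value-injective : ∀ {i j} → value i ≡ value j → i ≡ j
    value-injective {i} {j} eq = lookup-injective
      (AllPairs.filter⁺ (sat? 𝔄 everything)
        (AllPairs.map (λ { lt refl → Lex-irrefl (pow dim el) lt })
          (tuples-sorted (size 𝔄) dim))) i j
      (trans (sym (toVec-fromVec s _)) (trans (cong (toVec s) eq) (toVec-fromVec s _)))

    vertex : Val s 𝔄 → Vertex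
    vertex x = Any.index (∈-extension 𝔄 (toVec s x))

    value-vertex : ∀ x → value (vertex x) ≡ x
    value-vertex x = trans
      (cong (fromVec s) (sym (Any.lookup-index (∈-extension 𝔄 (toVec s x))))) (fromVec-toVec s x)

    vertex-injective : ∀ {x y} → vertex x ≡ vertex y → x ≡ y
    vertex-injective {x} {y} eq =
      trans (sym (value-vertex x)) (trans (cong value eq) (value-vertex y))

    pairs⇔ : ∀ i j → pairs (apply query 𝔄) (i , j) ⇔ Q 𝔄 (value i , value j)
    pairs⇔ i j = mk⇔ (λ t → to spec (to (T-does (sat? 𝔄 φ ρ)) t))
                     (λ q → from (T-does (sat? 𝔄 φ ρ)) (from spec q))
      where
      φ = formula D variablePair
      u = List.lookup (extension 𝔄 everything) i
      v = List.lookup (extension 𝔄 everything) j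
      ρ = u Vec.++ (v Vec.++ [])
      spec : Sat 𝔄 φ ρ ⇔ Q 𝔄 (value i , value j)
      spec = subst (λ z → Sat 𝔄 φ ρ ⇔ Q 𝔄 z) (eval-variablePair 𝔄 u v) (correct D 𝔄 ρ variablePair)

    -- Orientability is inherited along injective edge-preserving maps, and `vertex` and `value` are
    -- such maps in opposite directions.
    orientable⇔ : Orientable (λ i j → pairs (apply query 𝔄) (i , j)) ⇔
                  Orientable (λ x y → Q 𝔄 (x , y))
    orientable⇔ = mk⇔
      (Orientable-pullback vertex vertex-injective λ {x} {y} q → from (pairs⇔ (vertex x) (vertex y))
        (subst₂ (λ x y → Q 𝔄 (x , y)) (sym (value-vertex x)) (sym (value-vertex y)) q))
      (Orientable-pullback value value-injective λ {i} {j} → to (pairs⇔ i j))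

module Reduction {σ : Vocabulary} (word : Structure σ → List Bool)
  (tapeReader : Reader (framed ∘ word)) (M : TM) (c : ℕ) where
  open TM M
  -- The number of chunks comes from `log-capacity`; the exponent there is the width of an input
  -- position.
  open Simulation {σ} word tapeReader M (c * suc (width (position tapeReader) * 2)) public

  EdgeRelation : ∀ 𝔄 → Val Node 𝔄 → Val Node 𝔄 → Set
  EdgeRelation 𝔄 = Edge (λ x y → Next 𝔄 (x , y)) (marker chordCode 𝔄) (marker startCode 𝔄)

  Edge-def : Definable (Node ⊗ Node) (λ (𝔄 : Structure σ) (x , y) → EdgeRelation 𝔄 x y)
  Edge-def = equivalent (λ 𝔄 (x , y) → mk⇔
      (λ { (inj₁ refl) → loop ; (inj₂ (inj₁ n)) → next n ; (inj₂ (inj₂ (refl , refl))) → chord })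
      (λ { loop → inj₁ refl ; (next n) → inj₂ (inj₁ n) ; chord → inj₂ (inj₂ (refl , refl)) }))
    (≡-def Node ∨ᵈ
     substitute (λ (x , y) → y , x) (λ _ _ → refl) Next-def ∨ᵈ
     (substitute proj₁ (λ _ _ → refl) (marker-def chordCode) ∧ᵈ
      substitute proj₂ (λ _ _ → refl) (marker-def startCode)))

  chord≢start : ∀ 𝔄 → marker chordCode 𝔄 ≢ marker startCode 𝔄
  chord≢start 𝔄 eq = Fin.0≢1+n (unary-injective #codes {chordCode} {startCode} 𝔄 (cong proj₁ eq))

  open GraphQuery Node Edge-def (marker chordCode) (marker startCode) chord≢start public

  module _ (𝔄 : Structure σ) where

    module _ (bounded-space : InSpace M (word 𝔄) (c * suc ⌈log₂ length (word 𝔄) ⌉)) where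

      wkHead< : ∀ t → wkHead (run M (word 𝔄) t) < length (cells 𝔄)
      wkHead< t = <-≤-trans (bounded-space t) (≤-trans
        (log-capacity 𝔄 c (width input) (length (word 𝔄)) length-word≤)
        (≤-reflexive (sym (length-memory (c * suc (width input * 2)) 𝔄))))
        where
        length-word≤ : length (word 𝔄) ≤ size 𝔄 ^ width input
        length-word≤ = ≤-trans
          (≤-trans (m≤n+m _ 2) (≤-reflexive (sym (length-positions tapeReader 𝔄))))
          (bounded (enumeration tapeReader) 𝔄)

      encoded : ∀ t → ∃[ x ] Encodes 𝔄 (run M (word 𝔄) t) x
      encoded t = encode 𝔄 (run M (word 𝔄) t) (s≤s (inHead≤ M (word 𝔄) t)) (wkHead< t)

      -- The marker comes before the computation: time `t` is vertex `suc t`, so a halt at time `u`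
      -- gives a path of `suc u` steps.
      nodeAt : ℕ → Val Node 𝔄
      nodeAt zero    = marker startCode 𝔄
      nodeAt (suc t) = proj₁ (encoded t)

      nodeAt-next : ∀ {u} → (∀ {s} → s < u → halt (state (run M (word 𝔄) s)) ≡ nothing) →
        ∀ {t} → t < suc u → Next 𝔄 (nodeAt t , nodeAt (suc t))
      nodeAt-next running {zero}  _         = Next-start 𝔄 (proj₂ (encoded 0))
      nodeAt-next running {suc t} (s≤s t<u) =
        Next-running 𝔄 (proj₂ (encoded t)) (running t<u) (proj₂ (encoded (suc t)))

      start≢ : ∀ t → marker startCode 𝔄 ≢ nodeAt (suc t)
      start≢ t eq = Fin.0≢1+n (Fin.suc-injective (unary-injective #codes {startCode} {suc (suc _)} 𝔄
        (trans (cong proj₁ eq) (Encodes.state≡ (proj₂ (encoded t))))))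

      chord≢ : ∀ t → marker chordCode 𝔄 ≢ nodeAt t
      chord≢ zero       = chord≢start 𝔄
      chord≢ (suc t) eq = Fin.0≢1+n (unary-injective #codes {chordCode} {suc (suc _)} 𝔄
        (trans (cong proj₁ eq) (Encodes.state≡ (proj₂ (encoded t)))))

      -- As `M` halts, it accepts or rejects. A rejection leads back to the start marker and closes
      -- the path, which `¬orientable` excludes.
      orientable⇒accepts : Orientable (EdgeRelation 𝔄) → Halts M (word 𝔄) → Accepts M (word 𝔄)
      orientable⇒accepts O (t , true  , eq) = t , eq
      orientable⇒accepts O (t , false , eq)
        with u , rejects , running ← first-halt M (word 𝔄) t eq =
        contradiction O
          (¬orientable (λ x y → Next 𝔄 (x , y)) (Next-functional 𝔄) (marker chordCode 𝔄) nodeAt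
            (suc u) (nodeAt-next running) z<s (Next-reject 𝔄 (proj₂ (encoded u)) rejects)
            (Next-chord 𝔄) start≢ chord≢)

      -- The path stops at the first halting configuration, which accepts and thus has no successor.
      accepts⇒orientable : Accepts M (word 𝔄) → Orientable (EdgeRelation 𝔄)
      accepts⇒orientable (t , eq) with u , accepts , running ← first-halt M (word 𝔄) t eq =
        orientable (λ x y → Next 𝔄 (x , y)) (Next-functional 𝔄) (marker chordCode 𝔄) nodeAt (suc u)
          (nodeAt-next running) (_≟ₛ_ {s = Node}) (¬Next-accept 𝔄 (proj₂ (encoded u)) accepts)

theorem17 : {X : Set} (x y : X) → x ≢ y → (∀ v → v ≡ x ⊎ v ≡ y) →
    L-hard (MC x y (dep x y ∨ dep y x))
theorem17 x y x≢y exhaust {σ} P (ℒ , (M , (c , inSpace) , decides) , P⇔ℒ) = query , λ 𝔄 →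
  let inSpace𝔄 = inSpace (bin 𝔄)
      halts , ℒ⇔accepts = decides (bin 𝔄)
      MC⇔ = MC⇔Orientable x y x≢y exhaust (apply query 𝔄)
  in mk⇔
    (λ p → from MC⇔ (from (orientable⇔ 𝔄)
      (accepts⇒orientable 𝔄 inSpace𝔄 (to ℒ⇔accepts (to (P⇔ℒ 𝔄) p)))))
    (λ m → from (P⇔ℒ 𝔄) (from ℒ⇔accepts
      (orientable⇒accepts 𝔄 inSpace𝔄 (to (orientable⇔ 𝔄) (to MC⇔ m)) halts)))
  where open Reduction {σ} bin tapeReader M c
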